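{- Let $s=s(n)\ge n$ be an integer. If each edge of $K_{n,n}$ is given one of $s$ colors independently and uniformly at random, then with probability tending to $1$ as $n\to\infty$ the resulting edge-colored $K_{n,n}$ has a rainbow perfect matching.
   Context: $K_{n,n}$ is the complete bipartite graph with $n$ vertices in each part. A perfect matching of an edge-colored $K_{n,n}$ is rainbow if no two of its edges have the same color. The coloring described is the paper's uniform random model $\mathsf{URM}$ with $s$ colors. -}

module Defs where

open import Data.Fin using (Fin; quotient; remainder; finToFun)
open import Data.Fin.Properties using (_≟_; any?; all?)
open import Data.Fin.Subset using (Subset; _∈_)
open import Data.Fin.Subset.Properties using (_∈?_; anySubset?)
open import Data.Integer using (+_)
open import Data.Nat using (ℕ; zero; suc; _*_; _^_; _≤_; _≥_; NonZero; >-nonZero; s≤s; z≤n)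
open import Data.Nat.Properties using (m^n≢0; ≤-trans)
open import Data.Product using (∃-syntax; ∃!; _×_; _,_)
open import Data.Rational using (ℚ; 0ℚ; _<_; _-_; ∣_∣; _/_)
open import Data.Sum using (_⊎_; inj₁; inj₂; [_,_])
open import Data.Sum.Properties using (≡-dec)
open import Data.Vec using (count; tabulate)
open import Function using (_∘_)
open import Level using (Level)
open import Relation.Binary.PropositionalEquality using (_≡_; _≢_)
open import Relation.Nullary using (Dec; ¬?; _×-dec_; _⊎-dec_; _→-dec_)
open import Relation.Nullary.Decidable using (map′)
open import Relation.Unary using (Pred; Decidable)

private
  variable
    ℓ : Level
    m k : ℕ

-- The complete bipartite graph K_{n,n}.  Its n * n edges are indexed by
-- Fin (n * n), which `remQuot` identifies with Fin n × Fin n, so that the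
-- library's `Subset` and `finToFun` apply to sets and colorings of edges.

Vertex : ℕ → Set
Vertex n = Fin n ⊎ Fin n

Edge : ℕ → Set
Edge n = Fin (n * n)

IncidentTo : ∀ n → Vertex n → Edge n → Set
IncidentTo n v e = v ≡ inj₁ (quotient n e) ⊎ v ≡ inj₂ (remainder {n} n e)

Coloring : ℕ → ℕ → Set
Coloring n k = Edge n → Fin k

IsPerfectMatching : ∀ n → Subset (n * n) → Set
IsPerfectMatching n M =
  (v : Vertex n) → ∃! _≡_ λ (e : Edge n) → e ∈ M × IncidentTo n v e

IsRainbow : ∀ n {k} → Coloring n k → Subset (n * n) → Set
IsRainbow n c M = (e f : Edge n) → e ∈ M → f ∈ M → e ≢ f → c e ≢ c f

HasRainbowPerfectMatching : ∀ n {k} → Coloring n k → Set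
HasRainbowPerfectMatching n c =
  ∃[ M ] IsPerfectMatching n M × IsRainbow n c M

incidentTo? : ∀ n v → Decidable (IncidentTo n v)
incidentTo? n v e =
  v ≟ᵛ inj₁ (quotient n e) ⊎-dec v ≟ᵛ inj₂ (remainder {n} n e)
  where _≟ᵛ_ = ≡-dec _≟_ _≟_

∃!? : {P : Pred (Fin m) ℓ} → Decidable P → Dec (∃! _≡_ P)
∃!? P? = map′
  (λ (x , px , u) → x , px , λ {y} → u y)
  (λ (x , px , u) → x , px , λ y → u {y})
  (any? λ x → P? x ×-dec all? λ y → P? y →-dec x ≟ y)

isPerfectMatching? : ∀ n → Decidable (IsPerfectMatching n)
isPerfectMatching? n M = map′
  (λ (l , r) → [ l , r ])
  (λ h → h ∘ inj₁ , h ∘ inj₂)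
  (all? (unique? ∘ inj₁) ×-dec all? (unique? ∘ inj₂))
  where
  unique? : (v : Vertex n) → Dec (∃! _≡_ λ e → e ∈ M × IncidentTo n v e)
  unique? v = ∃!? λ e → e ∈? M ×-dec incidentTo? n v e

isRainbow? : ∀ n {k} (c : Coloring n k) → Decidable (IsRainbow n c)
isRainbow? n c M = all? λ e → all? λ f →
  e ∈? M →-dec f ∈? M →-dec ¬? (e ≟ f) →-dec ¬? (c e ≟ c f)

hasRainbowPerfectMatching? :
  ∀ n {k} → Decidable (HasRainbowPerfectMatching n {k})
hasRainbowPerfectMatching? n c =
  anySubset? λ M → isPerfectMatching? n M ×-dec isRainbow? n c M

-- Probability of an event when each of m values is drawn from Fin k
-- independently and uniformly, i.e. for a uniformly random function
-- Fin m → Fin k.  Each function is listed exactly once (up to pointwise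
-- equality), since `finToFun` is inverse to `funToFin`.

Pr : {P : Pred (Fin m → Fin k) ℓ} → Decidable P → .{{NonZero (k ^ m)}} → ℚ
Pr {m} {k} P? = + count P? (tabulate {n = k ^ m} finToFun) / (k ^ m)

-- The hypothesis k ≥ n makes the sample space nonempty, also for n = k = 0.

k^[n*n]≢0 : ∀ n {k} → k ≥ n → NonZero (k ^ (n * n))
k^[n*n]≢0 zero        _   = _
k^[n*n]≢0 (suc n) {k} k≥n =
  m^n≢0 k (suc n * suc n) {{>-nonZero (≤-trans (s≤s z≤n) k≥n)}}

PrRainbowPerfectMatching : (n k : ℕ) → k ≥ n → ℚ
PrRainbowPerfectMatching n k k≥n =
  Pr (hasRainbowPerfectMatching? n {k}) {{k^[n*n]≢0 n k≥n}}

TendsTo : (ℕ → ℚ) → ℚ → Set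
TendsTo a L = (ε : ℚ) → 0ℚ < ε → ∃[ N ] ((n : ℕ) → N ≤ n → ∣ a n - L ∣ < ε)

{-# OPTIONS --safe #-}

-- Second moment method.  Let X be the number of rainbow perfect matchings and
-- write [s]ₙ for the falling factorial.  Two perfect matchings with j common
-- edges are both rainbow with probability ([s]ₙ / sⁿ)² g(j), where
-- g(j) = sʲ / [s]ⱼ: given that the first is rainbow, so are the j common edges,
-- and the n - j other edges of the second are coloured independently.  Hence
-- E[X²] / E[X]² is the mean of g(F), F being the number of fixed points of a
-- uniformly random permutation.  Here g(0) = g(1) = 1, and P(F ≥ j) ≤ 1 / j!
-- by the factorial moments of F, so that
--   E[g(F)] - 1 ≤ ∑ⱼ (g(j + 1) - g(j)) / (j + 1)! ≤ (1 / n) ∑ⱼ j (2/3)ʲ⁻¹ = 9 / n.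
-- By the Cauchy-Schwarz inequality P(X > 0) ≥ E[X]² / E[X²] ≥ n / (n + 9).

module Submission where

open import Defs
open import Data.Nat using (ℕ; _≥_)
open import Data.Rational using (1ℚ)

import Algebra.Properties.CommutativeSemigroup as CommutativeSemigroupProperties
import Algebra.Properties.Semiring.Sum as SemiringSum
open import Data.Bool using (if_then_else_; true)
open import Data.Fin using (Fin; zero; suc; combine; quotient; remainder; finToFun; punchOut; _↑ˡ_; _↑ʳ_)
open import Data.Fin.Properties using (_≟_; any?; injective⇒≤; punchOut-injective; combine-injective; combine-remQuot; remQuot-combine)
open import Data.Fin.Subset using (Subset) renaming (_∈_ to _∈ˢ_)
import Data.Integer as ℤ
import Data.Integer.Properties as ℤ
open import Data.List as List using (List; []; _∷_; _++_; length; map; filter; allFin)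
open import Data.List.Membership.Propositional using (_∈_; _∉_)
open import Data.List.Membership.Propositional.Properties using (∈-map⁺; ∈-++⁻; ∈-∃++; ∈-allFin)
open import Data.List.Properties using (map-++; map-∘; length-++; length-map; length-tabulate; ++-identityʳ)
open import Data.List.Relation.Binary.Permutation.Propositional using (_↭_; refl; prep; swap; trans; ↭-sym; ↭-trans; ↭-reflexive)
open import Data.List.Relation.Binary.Permutation.Propositional.Properties using (∈-resp-↭; shift; ↭-length; ++⁺ʳ; map⁺)
open import Data.List.Relation.Unary.All as All using (All; []; _∷_)
open import Data.List.Relation.Unary.All.Properties using (all-filter) renaming (map⁺ to All-map⁺)
open import Data.List.Relation.Unary.Any using (here; there)
open import Data.List.Relation.Unary.Unique.Propositional using (Unique; []; _∷_)
import Data.List.Relation.Unary.Unique.Propositional.Properties as Unique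
open import Data.Nat using (zero; suc; pred; _+_; _*_; _∸_; _^_; _!; _⊓_; _≤_; _<_; z≤n; s≤s; NonZero; >-nonZero; >-nonZero⁻¹)
open import Data.Nat.Properties hiding (_≟_)
open import Data.Nat.Tactic.RingSolver using (solve-∀)
open import Data.Product using (∃!; ∃-syntax; _×_; _,_; proj₁; proj₂)
open import Data.Rational as ℚ using (ℚ; 0ℚ; _/_; _-_; ↧ₙ_; mkℚ; toℚᵘ)
import Data.Rational.Properties as ℚ
open import Data.Rational.Unnormalised as ℚᵘ using (mkℚᵘ; *<*)
import Data.Rational.Unnormalised.Properties as ℚᵘ
open import Data.Sum using (_⊎_; inj₁; inj₂)
open import Data.Sum.Properties using (inj₂-injective)
open import Data.Vec using (Vec; []; _∷_; lookup; tabulate; count; _[_]≔_)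
open import Data.Vec.Properties using (lookup∘update; lookup∘update′; lookup∘tabulate; []=⇒lookup; lookup⇒[]=; count≤n)
open import Function using (_∘_; id)
open import Function.Definitions using (Injective)
open import Level using (Level)
open import Relation.Binary.PropositionalEquality as ≡ using (_≡_; _≢_; _≗_; refl; sym; cong; cong₂; subst; subst₂; module ≡-Reasoning)
open import Relation.Nullary using (Dec; yes; no; does; ¬?; ¬_; contradiction)
open import Relation.Nullary.Decidable using (dec-true)
open import Relation.Unary using (Pred; Decidable)
open import Relation.Unary.Properties using (∁?)

open CommutativeSemigroupProperties *-commutativeSemigroup
  using (interchange; x∙yz≈y∙xz; xy∙z≈y∙xz; x∙yz≈xz∙y)
open SemiringSum +-*-semiring
  using (sum; sum-syntax; sum-cong-≗; ∑-comm; ∑-distrib-+; *-distribˡ-sum; *-distribʳ-sum)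

-- Until the final passage to rationals nothing is divided: a probability is a count, multiplied by
-- the denominators it would carry. Permutations are vectors in `Vec (Fin n) n` weighted by the 0/1
-- factor `isPerm`. Random permutations and random colourings are thus both handled by sums over all
-- vectors, and one argument, drawing the entries one by one (`distinct-peel`), yields the first
-- moment, the joint probability for two matchings and the number of permutations with prescribed
-- values. The constant 2/3 and the factor 1 / n arise as follows. Since s - (s - j) = j, the
-- difference g(j + 1) - g(j) equals j sʲ / [s]ⱼ₊₁. Division by (j + 1)! turns the denominator into
-- the product of (i + 1) (s - i) over 0 ≤ i ≤ j. This factor is concave in i; it is s at i = 0 and
-- i = s - 1, and at least 2 (s - 1) in between, which is at least 3 s / 2 once s ≥ 4. For j ≥ 1 the
-- product is therefore at least sʲ⁺¹ (3/2)ʲ⁻¹, one power of s more than the numerator has, and s ≥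
-- n.

private
  variable
    a p : Level
    A : Set a
    k m n : ℕ

-- Finite sums, and sums over all vectors

sum-mono-≤ : {f g : Fin n → ℕ} → (∀ i → f i ≤ g i) → sum f ≤ sum g
sum-mono-≤ {zero}  f≤g = z≤n
sum-mono-≤ {suc n} f≤g = +-mono-≤ (f≤g zero) (sum-mono-≤ (f≤g ∘ suc))

sum-const : ∀ n x → ∑[ _ < n ] x ≡ n * x
sum-const zero    x = refl
sum-const (suc n) x = cong (x +_) (sum-const n x)

sum-++ : ∀ a {b} (f : Fin (a + b) → ℕ) →
  sum f ≡ (∑[ i < a ] f (i ↑ˡ b)) + (∑[ j < b ] f (a ↑ʳ j))
sum-++ zero    f = refl
sum-++ (suc a) f =
  ≡.trans (cong (f zero +_) (sum-++ a (f ∘ suc))) (sym (+-assoc (f zero) _ _))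

sum-combine : ∀ a {b} (f : Fin (a * b) → ℕ) →
  sum f ≡ (∑[ i < a ] ∑[ j < b ] f (combine i j))
sum-combine zero        f = refl
sum-combine (suc a) {b} f =
  ≡.trans (sum-++ b f) (cong (sum (f ∘ (_↑ˡ a * b)) +_) (sum-combine a (f ∘ (b ↑ʳ_))))

-- The same enumeration of functions as in Pr.
vec : Fin (k ^ m) → Vec (Fin k) m
vec i = tabulate (finToFun i)

∑ⱽ : (Vec (Fin k) m → ℕ) → ℕ
∑ⱽ f = sum (f ∘ vec)

∑ⱽ-suc : (f : Vec (Fin k) (suc m) → ℕ) → ∑ⱽ f ≡ (∑[ x < k ] ∑ⱽ (f ∘ (x ∷_)))
∑ⱽ-suc {k} {m} f = ≡.trans (sum-combine k _)
  (sum-cong-≗ λ x → sum-cong-≗ λ i → cong (λ (q , r) → f (q ∷ vec r)) (remQuot-combine x i))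

∑ⱽ-const : ∀ k m x → ∑ⱽ {k} {m} (λ _ → x) ≡ k ^ m * x
∑ⱽ-const k m x = sum-const (k ^ m) x

-- Redrawing one coordinate preserves the uniform distribution: each vector arises from exactly k
-- pairs of `c` and `x`, the old entry of `c` at `e` being arbitrary.
∑ⱽ-resample : (e : Fin m) (f : Vec (Fin k) m → ℕ) →
  k * ∑ⱽ f ≡ ∑ⱽ λ c → ∑[ x < k ] f (c [ e ]≔ x)
∑ⱽ-resample {suc m} {k} zero f = begin
  k * ∑ⱽ f                                        ≡⟨ cong (k *_) (≡.trans (∑ⱽ-suc f) (∑-comm (λ x i → f (x ∷ vec i)))) ⟩
  k * ∑ⱽ {m = m} (λ c → ∑[ x < k ] f (x ∷ c))     ≡⟨ sum-const k _ ⟨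
  (∑[ _ < k ] ∑ⱽ {m = m} (λ c → ∑[ x < k ] f (x ∷ c))) ≡⟨ ∑ⱽ-suc (λ c → ∑[ x < k ] f (c [ zero ]≔ x)) ⟨
  ∑ⱽ (λ c → ∑[ x < k ] f (c [ zero ]≔ x))         ∎
  where open ≡-Reasoning
∑ⱽ-resample {suc m} {k} (suc e) f = begin
  k * ∑ⱽ f                                        ≡⟨ cong (k *_) (∑ⱽ-suc f) ⟩
  k * (∑[ y < k ] ∑ⱽ (f ∘ (y ∷_)))                ≡⟨ *-distribˡ-sum k (λ y → ∑ⱽ (f ∘ (y ∷_))) ⟩
  (∑[ y < k ] (k * ∑ⱽ (f ∘ (y ∷_))))              ≡⟨ sum-cong-≗ (λ y → ∑ⱽ-resample e (f ∘ (y ∷_))) ⟩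
  (∑[ y < k ] ∑ⱽ (λ c → ∑[ x < k ] f (y ∷ c [ e ]≔ x))) ≡⟨ ∑ⱽ-suc (λ c → ∑[ x < k ] f (c [ suc e ]≔ x)) ⟨
  ∑ⱽ (λ c → ∑[ x < k ] f (c [ suc e ]≔ x))        ∎
  where open ≡-Reasoning

-- Stands in for independence of `f` from the coordinate `e`.
Ignores : Fin m → (Vec (Fin k) m → A) → Set _
Ignores e f = ∀ c x → f (c [ e ]≔ x) ≡ f c

-- With all coordinates but `e` fixed, `h` is constant and the entry at `e` is uniform, so `q`
-- averages to K / k. The last hypothesis carries the factor `h c` because the sum of `q c` has to
-- be K only where `h c` is not 0.
∑ⱽ-peel : (e : Fin m) (h : Vec (Fin k) m → ℕ) (q : Vec (Fin k) m → Fin k → ℕ) (K : ℕ) →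
  Ignores e h → (∀ y → Ignores e (λ c → q c y)) →
  (∀ c → h c * sum (q c) ≡ h c * K) →
  k * ∑ⱽ (λ c → q c (lookup c e) * h c) ≡ K * ∑ⱽ h
∑ⱽ-peel {m} {k} e h q K h-ign q-ign h-sum = begin
  k * ∑ⱽ (λ c → q c (lookup c e) * h c)
    ≡⟨ ∑ⱽ-resample e (λ c → q c (lookup c e) * h c) ⟩
  ∑ⱽ (λ c → ∑[ x < k ] (q (c [ e ]≔ x) (lookup (c [ e ]≔ x) e) * h (c [ e ]≔ x)))
    ≡⟨ sum-cong-≗ (λ i → sum-cong-≗ (λ x → cong₂ _*_ (resampled (vec i) x) (h-ign (vec i) x))) ⟩
  ∑ⱽ {m = m} (λ c → ∑[ x < k ] (q c x * h c))
    ≡⟨ sum-cong-≗ {k ^ m} (λ i → *-distribʳ-sum (h (vec i)) (q (vec i))) ⟨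
  ∑ⱽ (λ c → sum (q c) * h c)
    ≡⟨ sum-cong-≗ {k ^ m} (λ i → ≡.trans (*-comm (sum (q (vec i))) _) (≡.trans (h-sum (vec i)) (*-comm (h (vec i)) K))) ⟩
  ∑ⱽ (λ c → K * h c)
    ≡⟨ *-distribˡ-sum K (h ∘ vec) ⟨
  K * ∑ⱽ h ∎
  where
  open ≡-Reasoning
  resampled : ∀ c x → q (c [ e ]≔ x) (lookup (c [ e ]≔ x) e) ≡ q c x
  resampled c x = ≡.trans (q-ign _ c x) (cong (q c) (lookup∘update e c x))

-- Indicators and lists without repetition

⟦_⟧ : {P : Set a} → Dec P → ℕ
⟦ d ⟧ = if does d then 1 else 0

⟦yes⟧ : {P : Set a} (d : Dec P) → P → ⟦ d ⟧ ≡ 1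
⟦yes⟧ (yes _) p = refl
⟦yes⟧ (no ¬p) p = contradiction p ¬p

⟦no⟧ : {P : Set a} (d : Dec P) → ¬ P → ⟦ d ⟧ ≡ 0
⟦no⟧ (yes p) ¬p = contradiction p ¬p
⟦no⟧ (no _)  ¬p = refl

⟦⟧≡1⇒ : {P : Set a} (d : Dec P) → ⟦ d ⟧ ≡ 1 → P
⟦⟧≡1⇒ (yes p) _ = p

⟦⟧≤1 : {P : Set a} (d : Dec P) → ⟦ d ⟧ ≤ 1
⟦⟧≤1 (yes _) = ≤-refl
⟦⟧≤1 (no  _) = z≤n

≤1-dichotomy : ∀ {x} → x ≤ 1 → x ≡ 0 ⊎ x ≡ 1
≤1-dichotomy {zero}        _         = inj₁ refl
≤1-dichotomy {suc zero}    _         = inj₂ refl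
≤1-dichotomy {suc (suc _)} (s≤s ())

-- Numbers 0 and 1 in place of propositions, so that conditions can be multiplied together and
-- summed over.
fresh : Fin k → List (Fin k) → ℕ
fresh x []      = 1
fresh x (y ∷ l) = ⟦ ¬? (x ≟ y) ⟧ * fresh x l

distinct : List (Fin k) → ℕ
distinct []      = 1
distinct (x ∷ l) = fresh x l * distinct l

fresh≤1 : (x : Fin k) (l : List (Fin k)) → fresh x l ≤ 1
fresh≤1 x []      = ≤-refl
fresh≤1 x (y ∷ l) = *-mono-≤ (⟦⟧≤1 (¬? (x ≟ y))) (fresh≤1 x l)

distinct≤1 : (l : List (Fin k)) → distinct l ≤ 1
distinct≤1 []      = ≤-refl
distinct≤1 (x ∷ l) = *-mono-≤ (fresh≤1 x l) (distinct≤1 l)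

fresh⇒∉ : {x : Fin k} {l : List (Fin k)} → fresh x l ≡ 1 → x ∉ l
fresh⇒∉ {x = x} {y ∷ l} p (here x≡y)  = ⟦⟧≡1⇒ (¬? (x ≟ y)) (m*n≡1⇒m≡1 _ (fresh x l) p) x≡y
fresh⇒∉ {x = x} {y ∷ l} p (there x∈l) = fresh⇒∉ (m*n≡1⇒n≡1 ⟦ ¬? (x ≟ y) ⟧ _ p) x∈l

fresh-map : (f : Fin m → Fin k) {x : Fin k} (l : List (Fin m)) →
  (∀ y → x ≢ f y) → fresh x (map f l) ≡ 1
fresh-map f         []      x≢f = refl
fresh-map f {x = x} (y ∷ l) x≢f = cong₂ _*_ (⟦yes⟧ (¬? (x ≟ f y)) (x≢f y)) (fresh-map f l x≢f)

distinct-map : {f : Fin m → Fin k} → Injective _≡_ _≡_ f →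
  ∀ l → distinct (map f l) ≡ distinct l
distinct-map {f = f} f-inj = go
  where
  ⟦≢⟧-inj : ∀ x y → ⟦ ¬? (f x ≟ f y) ⟧ ≡ ⟦ ¬? (x ≟ y) ⟧
  ⟦≢⟧-inj x y with x ≟ y
  ... | yes refl = ⟦no⟧ (¬? (f x ≟ f x)) (λ ¬p → ¬p refl)
  ... | no  x≢y  = ⟦yes⟧ (¬? (f x ≟ f y)) (x≢y ∘ f-inj)
  go-fresh : ∀ x l → fresh (f x) (map f l) ≡ fresh x l
  go-fresh x []      = refl
  go-fresh x (y ∷ l) = cong₂ _*_ (⟦≢⟧-inj x y) (go-fresh x l)
  go : ∀ l → distinct (map f l) ≡ distinct l
  go []      = refl
  go (x ∷ l) = cong₂ _*_ (go-fresh x l) (go l)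

⟦≢⟧-sym : (x y : Fin k) → ⟦ ¬? (x ≟ y) ⟧ ≡ ⟦ ¬? (y ≟ x) ⟧
⟦≢⟧-sym x y with x ≟ y
... | yes refl = sym (⟦no⟧ (¬? (x ≟ x)) (λ ¬p → ¬p refl))
... | no  x≢y  = sym (⟦yes⟧ (¬? (y ≟ x)) (x≢y ∘ sym))

fresh-↭ : (x : Fin k) {l l′ : List (Fin k)} → l ↭ l′ → fresh x l ≡ fresh x l′
fresh-↭ x refl         = refl
fresh-↭ x (prep y p)   = cong (⟦ ¬? (x ≟ y) ⟧ *_) (fresh-↭ x p)
fresh-↭ x (swap {xs} y z p) =
  ≡.trans (cong (λ r → ⟦ ¬? (x ≟ y) ⟧ * (⟦ ¬? (x ≟ z) ⟧ * r)) (fresh-↭ x p))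
          (x∙yz≈y∙xz ⟦ ¬? (x ≟ y) ⟧ ⟦ ¬? (x ≟ z) ⟧ _)
fresh-↭ x (trans p q)  = ≡.trans (fresh-↭ x p) (fresh-↭ x q)

distinct-↭ : {l l′ : List (Fin k)} → l ↭ l′ → distinct l ≡ distinct l′
distinct-↭ refl         = refl
distinct-↭ (prep x p)   = cong₂ _*_ (fresh-↭ x p) (distinct-↭ p)
distinct-↭ (swap {xs} {ys} x y p)
  rewrite fresh-↭ x p | fresh-↭ y p | distinct-↭ p | ⟦≢⟧-sym x y =
  interchange ⟦ ¬? (y ≟ x) ⟧ (fresh x ys) (fresh y ys) (distinct ys)
distinct-↭ (trans p q)  = ≡.trans (distinct-↭ p) (distinct-↭ q)

sum-≢ : (y : Fin n) (f : Fin n → ℕ) → (∑[ x < n ] (⟦ ¬? (x ≟ y) ⟧ * f x)) + f y ≡ sum f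
sum-≢ zero    f = ≡.trans (+-comm (sum (λ x → ⟦ ¬? (suc x ≟ zero) ⟧ * f (suc x))) (f zero))
  (cong (f zero +_) (sum-cong-≗ (λ x → +-identityʳ (f (suc x)))))
sum-≢ {suc n} (suc y) f = begin
  f zero + 0 + sum (λ x → ⟦ ¬? (suc x ≟ suc y) ⟧ * f (suc x)) + f (suc y)
    ≡⟨ cong₂ (λ a b → a + b + f (suc y)) (+-identityʳ (f zero)) (sum-cong-≗ λ x → cong (_* f (suc x)) (⟦suc⟧ x)) ⟩
  f zero + sum (λ x → ⟦ ¬? (x ≟ y) ⟧ * f (suc x)) + f (suc y)
    ≡⟨ +-assoc (f zero) _ _ ⟩
  f zero + (sum (λ x → ⟦ ¬? (x ≟ y) ⟧ * f (suc x)) + f (suc y))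
    ≡⟨ cong (f zero +_) (sum-≢ y (f ∘ suc)) ⟩
  sum f ∎
  where
  open ≡-Reasoning
  ⟦suc⟧ : ∀ x → ⟦ ¬? (suc x ≟ suc y) ⟧ ≡ ⟦ ¬? (x ≟ y) ⟧
  ⟦suc⟧ x with x ≟ y
  ... | yes _ = refl
  ... | no _  = refl

-- Each entry of `l` excludes exactly one further value, since it is fresh for the entries behind
-- it.
sum-fresh : (l : List (Fin n)) → distinct l ≡ 1 → (∑[ x < n ] fresh x l) + length l ≡ n
sum-fresh {n} []      _ = ≡.trans (+-identityʳ _) (≡.trans (sum-const n 1) (*-identityʳ n))
sum-fresh {n} (y ∷ l) d = begin
  (∑[ x < n ] fresh x (y ∷ l)) + suc (length l)         ≡⟨ cong (λ z → (∑[ x < n ] fresh x (y ∷ l)) + (z + length l)) (m*n≡1⇒m≡1 _ (distinct l) d) ⟨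
  (∑[ x < n ] fresh x (y ∷ l)) + (fresh y l + length l) ≡⟨ +-assoc (∑[ x < n ] fresh x (y ∷ l)) _ _ ⟨
  (∑[ x < n ] fresh x (y ∷ l)) + fresh y l + length l   ≡⟨ cong (_+ length l) (sum-≢ y (λ x → fresh x l)) ⟩
  (∑[ x < n ] fresh x l) + length l                     ≡⟨ sum-fresh l (m*n≡1⇒n≡1 (fresh y l) _ d) ⟩
  n                                                     ∎
  where open ≡-Reasoning

-- Each entry of `l` suppresses at most one summand, and that summand is at most 1.
sum-≤-fresh : (l : List (Fin n)) (f : Fin n → ℕ) → (∀ x → f x ≤ 1) →
  sum f ≤ (∑[ x < n ] (fresh x l * f x)) + length l
sum-≤-fresh []      f f≤1 = ≤-reflexive
  (≡.trans (sum-cong-≗ (λ x → sym (+-identityʳ (f x)))) (sym (+-identityʳ _)))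
sum-≤-fresh {n} (y ∷ l) f f≤1 = begin
  sum f
    ≤⟨ sum-≤-fresh l f f≤1 ⟩
  sum g + length l
    ≡⟨ cong (_+ length l) (sum-≢ y g) ⟨
  (∑[ x < n ] (⟦ ¬? (x ≟ y) ⟧ * g x)) + g y + length l
    ≤⟨ +-monoˡ-≤ (length l) (+-mono-≤ (≤-reflexive (sum-cong-≗ λ x → sym (*-assoc ⟦ ¬? (x ≟ y) ⟧ (fresh x l) (f x))))
         (*-mono-≤ (fresh≤1 y l) (f≤1 y))) ⟩
  (∑[ x < n ] (fresh x (y ∷ l) * f x)) + 1 + length l
    ≡⟨ +-assoc (∑[ x < n ] (fresh x (y ∷ l) * f x)) 1 _ ⟩
  (∑[ x < n ] (fresh x (y ∷ l) * f x)) + suc (length l) ∎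
  where
  open ≤-Reasoning
  g : Fin n → ℕ
  g x = fresh x l * f x

-- Falling factorials

fall : ℕ → ℕ → ℕ
fall s zero    = 1
-- For t > s a factor 0 occurs, in keeping with the absence of injections from t positions into s
-- values.
fall s (suc t) = s * fall (s ∸ 1) t

fall-+ : ∀ s a b → fall s (a + b) ≡ fall s a * fall (s ∸ a) b
fall-+ s zero    b = sym (+-identityʳ _)
fall-+ s (suc a) b = begin
  s * fall (s ∸ 1) (a + b)                        ≡⟨ cong (s *_) (fall-+ (s ∸ 1) a b) ⟩
  s * (fall (s ∸ 1) a * fall (s ∸ 1 ∸ a) b)       ≡⟨ *-assoc s _ _ ⟨
  fall s (suc a) * fall (s ∸ 1 ∸ a) b             ≡⟨ cong (λ r → fall s (suc a) * fall r b) (∸-+-assoc s 1 a) ⟩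
  fall s (suc a) * fall (s ∸ suc a) b             ∎
  where open ≡-Reasoning

-- The last factor is split off instead of the first: the head of a list is drawn after its tail and
-- has the fewest values left.
fall-suc : ∀ s t → fall s (suc t) ≡ (s ∸ t) * fall s t
fall-suc s t = begin
  fall s (suc t)                  ≡⟨ cong (fall s) (+-comm 1 t) ⟩
  fall s (t + 1)                  ≡⟨ fall-+ s t 1 ⟩
  fall s t * ((s ∸ t) * 1)        ≡⟨ cong (fall s t *_) (*-identityʳ (s ∸ t)) ⟩
  fall s t * (s ∸ t)              ≡⟨ *-comm (fall s t) _ ⟩
  (s ∸ t) * fall s t              ∎
  where open ≡-Reasoning

fall-! : ∀ n → fall n n ≡ n !
fall-! zero    = refl
fall-! (suc n) = cong (suc n *_) (fall-! n)

fall-mono-≤ : ∀ {s s′} t → s ≤ s′ → fall s t ≤ fall s′ t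
fall-mono-≤ zero    s≤s′ = ≤-refl
fall-mono-≤ (suc t) s≤s′ = *-mono-≤ s≤s′ (fall-mono-≤ t (∸-monoˡ-≤ 1 s≤s′))

fall>0 : ∀ {s t} → t ≤ s → 0 < fall s t
fall>0 z≤n       = s≤s z≤n
fall>0 {suc s} {suc t} (s≤s t≤s) = *-mono-≤ {1} {suc s} (s≤s z≤n) (fall>0 t≤s)

-- Values of a random vector at a list of positions

at : Vec (Fin k) m → List (Fin m) → List (Fin k)
at c = map (lookup c)

at-ignores : {e : Fin m} (l : List (Fin m)) → fresh e l ≡ 1 → Ignores {k = k} e (λ c → at c l)
at-ignores         []      _ c x = refl
at-ignores {e = e} (y ∷ l) p c x = cong₂ _∷_
  (lookup∘update′ (λ y≡e → fresh⇒∉ {l = y ∷ l} p (here (sym y≡e))) c x)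
  (at-ignores l (m*n≡1⇒n≡1 ⟦ ¬? (e ≟ y) ⟧ _ p) c x)

-- The values at z are drawn one after the other, each avoiding all values used
-- so far; by the last hypothesis on h the values at j are distinct whenever
-- h c ≠ 0.
distinct-peel : (z j : List (Fin m)) (h : Vec (Fin k) m → ℕ) →
  distinct (z ++ j) ≡ 1 →
  All (λ e → Ignores e h) z →
  (∀ c → h c * distinct (at c j) ≡ h c) →
  k ^ length z * ∑ⱽ (λ c → h c * distinct (at c (z ++ j))) ≡ fall (k ∸ length j) (length z) * ∑ⱽ h
distinct-peel []      j h d [] h-j = cong (_+ 0) (sum-cong-≗ (λ i → h-j (vec i)))
distinct-peel {m} {k} (e ∷ z) j h d (i-e ∷ i-z) h-j = begin
  k * k ^ length z * ∑ⱽ (λ c → h c * distinct (at c (e ∷ z ++ j)))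
    ≡⟨ cong (k * k ^ length z *_) (sum-cong-≗ {k ^ m} (λ i → x∙yz≈y∙xz (h (vec i)) (fresh (lookup (vec i) e) (at (vec i) (z ++ j))) _)) ⟩
  k * k ^ length z * ∑ⱽ (λ c → fresh (lookup c e) (at c (z ++ j)) * h′ c)
    ≡⟨ xy∙z≈y∙xz k (k ^ length z) _ ⟩
  k ^ length z * (k * ∑ⱽ (λ c → fresh (lookup c e) (at c (z ++ j)) * h′ c))
    ≡⟨ cong (k ^ length z *_) (∑ⱽ-peel e h′ (λ c x → fresh x (at c (z ++ j))) (k ∸ length j ∸ length z) h′-ign q-ign sum-fresh-values) ⟩
  k ^ length z * ((k ∸ length j ∸ length z) * ∑ⱽ h′)
    ≡⟨ x∙yz≈y∙xz (k ^ length z) (k ∸ length j ∸ length z) _ ⟩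
  (k ∸ length j ∸ length z) * (k ^ length z * ∑ⱽ h′)
    ≡⟨ cong ((k ∸ length j ∸ length z) *_) (distinct-peel z j h (m*n≡1⇒n≡1 (fresh e (z ++ j)) _ d) i-z h-j) ⟩
  (k ∸ length j ∸ length z) * (fall (k ∸ length j) (length z) * ∑ⱽ h)
    ≡⟨ *-assoc (k ∸ length j ∸ length z) _ _ ⟨
  (k ∸ length j ∸ length z) * fall (k ∸ length j) (length z) * ∑ⱽ h
    ≡⟨ cong (_* ∑ⱽ h) (fall-suc (k ∸ length j) (length z)) ⟨
  fall (k ∸ length j) (suc (length z)) * ∑ⱽ h ∎
  where
  open ≡-Reasoning
  h′ : Vec (Fin k) m → ℕ
  h′ c = h c * distinct (at c (z ++ j))
  ign : Ignores e (λ c → at c (z ++ j))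
  ign = at-ignores (z ++ j) (m*n≡1⇒m≡1 _ (distinct (z ++ j)) d)
  h′-ign : Ignores e h′
  h′-ign c x = cong₂ _*_ (i-e c x) (cong distinct (ign c x))
  q-ign : ∀ y → Ignores e (λ c → fresh y (at c (z ++ j)))
  q-ign y c x = cong (fresh y) (ign c x)
  length-at : ∀ c → length (at c (z ++ j)) ≡ length j + length z
  length-at c = ≡.trans (length-map (lookup c) (z ++ j)) (≡.trans (length-++ z) (+-comm (length z) _))
  sum-fresh-values : ∀ c → h′ c * sum (λ x → fresh x (at c (z ++ j))) ≡ h′ c * (k ∸ length j ∸ length z)
  sum-fresh-values c with ≤1-dichotomy (distinct≤1 (at c (z ++ j)))
  -- If two values at `z ++ j` coincide, more fresh values may remain than claimed, but then `h′ c`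
  -- is 0.
  ... | inj₁ d≡0 rewrite d≡0 | *-zeroʳ (h c) = refl
  ... | inj₂ d≡1 = cong (h′ c *_) (begin
    sum (λ x → fresh x l)                       ≡⟨ m+n∸n≡m _ (length l) ⟨
    sum (λ x → fresh x l) + length l ∸ length l ≡⟨ cong (_∸ length l) (sum-fresh l d≡1) ⟩
    k ∸ length l                                ≡⟨ cong (k ∸_) (length-at c) ⟩
    k ∸ (length j + length z)                   ≡⟨ ∸-+-assoc k (length j) (length z) ⟨
    k ∸ length j ∸ length z                     ∎)
    where l = at c (z ++ j)

-- `distinct-peel` with nothing drawn beforehand: `j` empty and `h` constantly 1.
∑ⱽ-distinct : (l : List (Fin m)) → distinct l ≡ 1 →
  k ^ length l * ∑ⱽ {k} {m} (λ c → distinct (at c l)) ≡ fall k (length l) * k ^ m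
∑ⱽ-distinct {m} {k} l d = begin
  k ^ length l * ∑ⱽ {k} {m} (λ c → distinct (at c l))
    ≡⟨ cong (k ^ length l *_) (sum-cong-≗ {k ^ m} λ i → ≡.trans (sym (*-identityˡ _)) (cong (λ l → 1 * distinct (at (vec i) l)) (sym (++-identityʳ l)))) ⟩
  k ^ length l * ∑ⱽ {k} {m} (λ c → 1 * distinct (at c (l ++ [])))
    ≡⟨ distinct-peel l [] (λ _ → 1) (≡.trans (cong distinct (++-identityʳ l)) d) (All.tabulate (λ _ _ _ → refl)) (λ _ → refl) ⟩
  fall k (length l) * ∑ⱽ {k} {m} (λ _ → 1)
    ≡⟨ cong (fall k (length l) *_) (≡.trans (∑ⱽ-const k m 1) (*-identityʳ _)) ⟩
  fall k (length l) * k ^ m ∎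
  where open ≡-Reasoning

-- Agreement with a fixed function on a list of positions

agree : (Fin m → Fin k) → Vec (Fin k) m → List (Fin m) → ℕ
agree f c []      = 1
agree f c (x ∷ l) = ⟦ lookup c x ≟ f x ⟧ * agree f c l

sum-≡ : (y : Fin n) → (∑[ x < n ] ⟦ x ≟ y ⟧) ≡ 1
sum-≡ {suc n} zero    = cong suc (≡.trans (sum-const n 0) (*-zeroʳ n))
sum-≡ {suc n} (suc y) = ≡.trans (sum-cong-≗ ⟦suc⟧) (sum-≡ y)
  where
  ⟦suc⟧ : ∀ x → ⟦ suc x ≟ suc y ⟧ ≡ ⟦ x ≟ y ⟧
  ⟦suc⟧ x with x ≟ y
  ... | yes _ = refl
  ... | no _  = refl

agree-ignores : {f : Fin m → Fin k} {e : Fin m} (l : List (Fin m)) → fresh e l ≡ 1 → Ignores e (λ c → agree f c l)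
agree-ignores         []      _ c x = refl
agree-ignores {f = f} {e} (y ∷ l) p c x = cong₂ _*_
  (cong (λ z → ⟦ z ≟ f y ⟧) (lookup∘update′ (λ y≡e → fresh⇒∉ {l = y ∷ l} p (here (sym y≡e))) c x))
  (agree-ignores l (m*n≡1⇒n≡1 ⟦ ¬? (e ≟ y) ⟧ _ p) c x)

∑ⱽ-agree : (f : Fin m → Fin k) (l : List (Fin m)) → distinct l ≡ 1 →
  k ^ length l * ∑ⱽ (λ c → agree f c l) ≡ k ^ m
∑ⱽ-agree {m} {k} f []      _ = ≡.trans (+-identityʳ _) (≡.trans (∑ⱽ-const k m 1) (*-identityʳ _))
∑ⱽ-agree {m} {k} f (e ∷ l) d = begin
  k * k ^ length l * ∑ⱽ (λ c → agree f c (e ∷ l))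
    ≡⟨ xy∙z≈y∙xz k (k ^ length l) _ ⟩
  k ^ length l * (k * ∑ⱽ (λ c → agree f c (e ∷ l)))
    ≡⟨ cong (k ^ length l *_) (∑ⱽ-peel e (λ c → agree f c l) (λ _ x → ⟦ x ≟ f e ⟧) 1
         (agree-ignores l (m*n≡1⇒m≡1 _ (distinct l) d)) (λ _ _ _ → refl) (λ c → cong (agree f c l *_) (sum-≡ (f e)))) ⟩
  k ^ length l * (1 * ∑ⱽ (λ c → agree f c l))
    ≡⟨ cong (k ^ length l *_) (*-identityˡ _) ⟩
  k ^ length l * ∑ⱽ (λ c → agree f c l)
    ≡⟨ ∑ⱽ-agree f l (m*n≡1⇒n≡1 (fresh e l) _ d) ⟩
  k ^ m ∎
  where
  open ≡-Reasoning

-- A fresh `x` cannot lie in `l`, so it lies in the remainder found for `l` and is taken out of it.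
-- The remainder lists the positions still to be drawn once those in `l` are fixed.
complement : (l : List (Fin n)) → distinct l ≡ 1 → ∃[ r ] r ++ l ↭ allFin n
complement {n} []      _ = allFin n , ↭-reflexive (++-identityʳ _)
complement     (x ∷ l) d
  with r , r++l↭ ← complement l (m*n≡1⇒n≡1 (fresh x l) _ d)
  with ∈-++⁻ r (∈-resp-↭ (↭-sym r++l↭) (∈-allFin x))
... | inj₂ x∈l = contradiction x∈l (fresh⇒∉ (m*n≡1⇒m≡1 _ (distinct l) d))
... | inj₁ x∈r with ys , zs , refl ← ∈-∃++ x∈r =
  ys ++ zs , ↭-trans (shift x (ys ++ zs) l) (↭-trans (++⁺ʳ l (↭-sym (shift x ys zs))) r++l↭)

agree≤1 : (f : Fin m → Fin k) (c : Vec (Fin k) m) (l : List (Fin m)) → agree f c l ≤ 1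
agree≤1 f c []      = ≤-refl
agree≤1 f c (x ∷ l) = *-mono-≤ (⟦⟧≤1 (lookup c x ≟ f x)) (agree≤1 f c l)

agree⇒at≡map : (f : Fin m → Fin k) (c : Vec (Fin k) m) (l : List (Fin m)) →
  agree f c l ≡ 1 → at c l ≡ map f l
agree⇒at≡map f c []      _ = refl
agree⇒at≡map f c (x ∷ l) p = cong₂ _∷_
  (⟦⟧≡1⇒ (lookup c x ≟ f x) (m*n≡1⇒m≡1 _ (agree f c l) p))
  (agree⇒at≡map f c l (m*n≡1⇒n≡1 ⟦ lookup c x ≟ f x ⟧ _ p))

distinct-++ʳ : (l l′ : List (Fin k)) → distinct (l ++ l′) ≡ 1 → distinct l′ ≡ 1
distinct-++ʳ []      l′ d = d
distinct-++ʳ (x ∷ l) l′ d = distinct-++ʳ l l′ (m*n≡1⇒n≡1 (fresh x (l ++ l′)) _ d)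

-- Random permutations and their agreements with a fixed one

distinct-allFin : ∀ n → distinct (allFin n) ≡ 1
distinct-allFin n = unique (Unique.allFin⁺ n)
  where
  unique : {l : List (Fin n)} → Unique l → distinct l ≡ 1
  unique []                = refl
  unique (_∷_ {x} {xs} x≢ u) = cong₂ _*_ (fresh≡1 xs x≢) (unique u)
    where
    fresh≡1 : ∀ ys → All (x ≢_) ys → fresh x ys ≡ 1
    fresh≡1 []       []         = refl
    fresh≡1 (y ∷ ys) (x≢y ∷ ps) = cong₂ _*_ (⟦yes⟧ (¬? (x ≟ y)) x≢y) (fresh≡1 ys ps)

length-allFin : ∀ n → length (allFin n) ≡ n
length-allFin n = length-tabulate id

isPerm : Vec (Fin n) n → ℕ
isPerm {n} τ = distinct (at τ (allFin n))

n^n≢0 : ∀ n → NonZero (n ^ n)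
n^n≢0 zero    = _
n^n≢0 (suc n) = m^n≢0 (suc n) (suc n)

∑ⱽ-isPerm : ∀ n → ∑ⱽ (isPerm {n}) ≡ n !
∑ⱽ-isPerm n = *-cancelˡ-≡ _ _ (n ^ n) {{n^n≢0 n}} (begin
  n ^ n * ∑ⱽ (isPerm {n})                       ≡⟨ cong (λ t → n ^ t * ∑ⱽ (isPerm {n})) (length-allFin n) ⟨
  n ^ length (allFin n) * ∑ⱽ (isPerm {n})       ≡⟨ ∑ⱽ-distinct (allFin n) (distinct-allFin n) ⟩
  fall n (length (allFin n)) * n ^ n            ≡⟨ cong (λ t → fall n t * n ^ n) (length-allFin n) ⟩
  fall n n * n ^ n                              ≡⟨ *-comm (fall n n) _ ⟩
  n ^ n * fall n n                              ≡⟨ cong (n ^ n *_) (fall-! n) ⟩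
  n ^ n * n !                                   ∎)
  where open ≡-Reasoning

-- The F of the overview: for permutations this counts the fixed points of σ⁻¹τ with f = σ and c =
-- τ. Keeping σ avoids composing and inverting vectors.
agreements : (Fin m → Fin k) → Vec (Fin k) m → ℕ
agreements f c = ∑[ x < _ ] ⟦ lookup c x ≟ f x ⟧

module _ (σ : Fin n → Fin n) (σ-perm : distinct (map σ (allFin n)) ≡ 1) where

  -- The values at `l` are forced, and they are distinct because σ is injective. The remaining
  -- positions `r` are then drawn by `distinct-peel` from the values left over.
  ∑ⱽ-perm-agree : (l : List (Fin n)) → distinct l ≡ 1 →
    ∑ⱽ (λ τ → agree σ τ l * isPerm τ) ≡ (n ∸ length l) !
  ∑ⱽ-perm-agree l d with r , r++l↭ ← complement l d = *-cancelˡ-≡ _ _ (n ^ n) {{n^n≢0 n}} (begin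
    n ^ n * ∑ⱽ (λ τ → agree σ τ l * isPerm τ)
      ≡⟨ cong₂ _*_ (cong (n ^_) (sym |r|+|l|)) (sum-cong-≗ {n ^ n} (λ i → cong (agree σ (vec i) l *_) (distinct-↭ (map⁺ (lookup (vec i)) (↭-sym r++l↭))))) ⟩
    n ^ (length r + length l) * S
      ≡⟨ cong (_* S) (^-distribˡ-+-* n (length r) (length l)) ⟩
    n ^ length r * n ^ length l * S
      ≡⟨ xy∙z≈y∙xz (n ^ length r) (n ^ length l) S ⟩
    n ^ length l * (n ^ length r * S)
      ≡⟨ cong (n ^ length l *_) (distinct-peel r l (λ τ → agree σ τ l) r++l-distinct (ignores r r++l-distinct) absorb) ⟩
    n ^ length l * (fall (n ∸ length l) (length r) * ∑ⱽ (λ τ → agree σ τ l))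
      ≡⟨ x∙yz≈xz∙y (n ^ length l) _ _ ⟩
    n ^ length l * ∑ⱽ (λ τ → agree σ τ l) * fall (n ∸ length l) (length r)
      ≡⟨ cong₂ _*_ (∑ⱽ-agree σ l d) (cong (fall (n ∸ length l)) |r|) ⟩
    n ^ n * fall (n ∸ length l) (n ∸ length l)
      ≡⟨ cong (n ^ n *_) (fall-! (n ∸ length l)) ⟩
    n ^ n * (n ∸ length l) ! ∎)
    where
    open ≡-Reasoning
    S : ℕ
    S = ∑ⱽ (λ τ → agree σ τ l * distinct (at τ (r ++ l)))
    |r|+|l| : length r + length l ≡ n
    |r|+|l| = ≡.trans (sym (length-++ r)) (≡.trans (↭-length r++l↭) (length-allFin n))
    |r| : length r ≡ n ∸ length l
    |r| = ≡.trans (sym (m+n∸n≡m _ (length l))) (cong (_∸ length l) |r|+|l|)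
    r++l-distinct : distinct (r ++ l) ≡ 1
    r++l-distinct = ≡.trans (distinct-↭ r++l↭) (distinct-allFin n)
    ignores : ∀ r → distinct (r ++ l) ≡ 1 → All (λ e → Ignores e (λ τ → agree σ τ l)) r
    ignores []      _ = []
    ignores (e ∷ r) d =
      agree-ignores l (fresh-++ʳ r (m*n≡1⇒m≡1 _ (distinct (r ++ l)) d)) ∷ ignores r (m*n≡1⇒n≡1 (fresh e (r ++ l)) _ d)
      where
      fresh-++ʳ : ∀ r → fresh e (r ++ l) ≡ 1 → fresh e l ≡ 1
      fresh-++ʳ []      p = p
      fresh-++ʳ (x ∷ r) p = fresh-++ʳ r (m*n≡1⇒n≡1 ⟦ ¬? (e ≟ x) ⟧ _ p)
    σl-distinct : distinct (map σ l) ≡ 1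
    σl-distinct = distinct-++ʳ (map σ r) (map σ l)
      (≡.trans (cong distinct (sym (map-++ σ r l))) (≡.trans (distinct-↭ (map⁺ σ r++l↭)) σ-perm))
    absorb : ∀ τ → agree σ τ l * distinct (at τ l) ≡ agree σ τ l
    absorb τ with ≤1-dichotomy (agree≤1 σ τ l)
    ... | inj₁ ≡0 rewrite ≡0 = refl
    ... | inj₂ ≡1 = ≡.trans (cong (λ l′ → agree σ τ l * distinct l′) (agree⇒at≡map σ τ l ≡1))
      (≡.trans (cong (agree σ τ l *_) σl-distinct) (*-identityʳ _))

  -- Induction on t by revealing one more common value; for l = [] this is
  -- the t-th factorial moment of the number of agreements with σ.
  ∑ⱽ-perm-agree-fall : ∀ t (l : List (Fin n)) → distinct l ≡ 1 →
    ∑ⱽ (λ τ → agree σ τ l * isPerm τ * fall (agreements σ τ ∸ length l) t) ≤ (n ∸ length l) !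
  ∑ⱽ-perm-agree-fall zero l d = ≤-reflexive
    (≡.trans (sum-cong-≗ {n ^ n} (λ i → *-identityʳ _)) (∑ⱽ-perm-agree l d))
  ∑ⱽ-perm-agree-fall (suc t) l d = begin
    ∑ⱽ (λ τ → agree σ τ l * isPerm τ * fall (agreements σ τ ∸ length l) (suc t))
      ≤⟨ sum-mono-≤ {n ^ n} (λ i → split (vec i)) ⟩
    ∑ⱽ {m = n} (λ τ → ∑[ x < n ] (fresh x l * g x τ))
      ≡⟨ ∑-comm {n ^ n} {n} (λ i x → fresh x l * g x (vec i)) ⟩
    (∑[ x < n ] ∑ⱽ (λ τ → fresh x l * g x τ))
      ≡⟨ sum-cong-≗ (λ x → sym (*-distribˡ-sum (fresh x l) (g x ∘ vec))) ⟩
    (∑[ x < n ] (fresh x l * ∑ⱽ (g x)))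
      ≤⟨ sum-mono-≤ step ⟩
    (∑[ x < n ] (fresh x l * (n ∸ suc (length l)) !))
      ≡⟨ *-distribʳ-sum ((n ∸ suc (length l)) !) (λ x → fresh x l) ⟨
    (∑[ x < n ] fresh x l) * (n ∸ suc (length l)) !
      ≡⟨ cong₂ (λ a b → a * b !) (≡.trans (sym (m+n∸n≡m _ (length l))) (cong (_∸ length l) (sum-fresh l d))) (sym (≡.trans (∸-+-assoc n (length l) 1) (cong (n ∸_) (+-comm (length l) 1)))) ⟩
    (n ∸ length l) * (n ∸ length l ∸ 1) !
      ≤⟨ *pred!≤! (n ∸ length l) ⟩
    (n ∸ length l) ! ∎
    where
    open ≤-Reasoning
    *pred!≤! : ∀ x → x * (x ∸ 1) ! ≤ x !
    *pred!≤! zero    = z≤n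
    *pred!≤! (suc x) = ≤-refl
    g : Fin n → Vec (Fin n) n → ℕ
    g x τ = agree σ τ (x ∷ l) * isPerm τ * fall (agreements σ τ ∸ suc (length l)) t
    step : ∀ x → fresh x l * ∑ⱽ (g x) ≤ fresh x l * (n ∸ suc (length l)) !
    step x with ≤1-dichotomy (fresh≤1 x l)
    ... | inj₁ ≡0 rewrite ≡0 = z≤n
    ... | inj₂ ≡1 = *-monoʳ-≤ (fresh x l) (∑ⱽ-perm-agree-fall t (x ∷ l) (cong₂ _*_ ≡1 d))
    split : ∀ τ → agree σ τ l * isPerm τ * fall (agreements σ τ ∸ length l) (suc t) ≤ (∑[ x < n ] (fresh x l * g x τ))
    split τ = begin
      u * ((F ∸ length l) * fall (F ∸ length l ∸ 1) t)
        ≡⟨ cong (λ z → u * ((F ∸ length l) * fall z t)) (≡.trans (∸-+-assoc F (length l) 1) (cong (F ∸_) (+-comm (length l) 1))) ⟩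
      -- At most `length l` of the F agreements lie in `l`; any of the others, counted by `G`, can
      -- be the next one revealed.
      u * ((F ∸ length l) * f)
        ≤⟨ *-monoʳ-≤ u (*-monoˡ-≤ f (m≤n+o⇒m∸n≤o F (length l) (≤-trans (sum-≤-fresh l (λ x → ⟦ lookup τ x ≟ σ x ⟧) (λ x → ⟦⟧≤1 (lookup τ x ≟ σ x))) (≤-reflexive (+-comm _ (length l)))))) ⟩
      u * (G * f)
        ≡⟨ x∙yz≈y∙xz u G f ⟩
      G * (u * f)
        ≡⟨ *-distribʳ-sum (u * f) (λ x → fresh x l * ⟦ lookup τ x ≟ σ x ⟧) ⟩
      (∑[ x < n ] (fresh x l * ⟦ lookup τ x ≟ σ x ⟧ * (u * f)))
        ≡⟨ sum-cong-≗ (λ x → regroup (fresh x l) ⟦ lookup τ x ≟ σ x ⟧ (agree σ τ l) (isPerm τ) f) ⟩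
      (∑[ x < n ] (fresh x l * g x τ)) ∎
      where
      F = agreements σ τ
      u = agree σ τ l * isPerm τ
      f = fall (F ∸ suc (length l)) t
      G = ∑[ x < n ] (fresh x l * ⟦ lookup τ x ≟ σ x ⟧)
      regroup : ∀ a b c d e → a * b * (c * d * e) ≡ a * (b * c * d * e)
      regroup = solve-∀

  -- Markov's inequality for the t-th factorial moment, since `fall F t` is at least `t !` whenever
  -- t ≤ F.
  ∑ⱽ-perm-agreements≥ : ∀ t → ∑ⱽ (λ τ → isPerm τ * ⟦ t ≤? agreements σ τ ⟧) * t ! ≤ n !
  ∑ⱽ-perm-agreements≥ t = begin
    ∑ⱽ (λ τ → isPerm τ * ⟦ t ≤? agreements σ τ ⟧) * t !
      ≡⟨ *-distribʳ-sum {n ^ n} (t !) (λ i → isPerm {n} (vec i) * ⟦ t ≤? agreements σ (vec i) ⟧) ⟩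
    ∑ⱽ (λ τ → isPerm τ * ⟦ t ≤? agreements σ τ ⟧ * t !)
      ≤⟨ sum-mono-≤ {n ^ n} (λ i → pointwise (vec i)) ⟩
    ∑ⱽ (λ τ → 1 * isPerm τ * fall (agreements σ τ) t)
      ≤⟨ ∑ⱽ-perm-agree-fall t [] refl ⟩
    n ! ∎
    where
    open ≤-Reasoning
    pointwise : ∀ τ → isPerm τ * ⟦ t ≤? agreements σ τ ⟧ * t ! ≤ 1 * isPerm τ * fall (agreements σ τ) t
    pointwise τ = ≤-trans (≤-reflexive (*-assoc (isPerm τ) _ _)) (*-mono-≤ (≤-reflexive (sym (*-identityˡ (isPerm τ)))) (bound (agreements σ τ) (t ≤? agreements σ τ)))
      where
      bound : ∀ F (t≤F? : Dec (t ≤ F)) → ⟦ t≤F? ⟧ * t ! ≤ fall F t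
      bound F (no  _)   = z≤n
      bound F (yes t≤F) = ≤-trans (≤-reflexive (≡.trans (*-identityˡ (t !)) (sym (fall-! t)))) (fall-mono-≤ t t≤F)

-- Lower bounds for factorial times falling factorial

*-^ : ∀ a b j → (a * b) ^ j ≡ a ^ j * b ^ j
*-^ a b zero    = refl
*-^ a b (suc j) = ≡.trans (cong (a * b *_) (*-^ a b j)) (interchange a b (a ^ j) (b ^ j))

-- The factor with i = j + 1. With s = 2 + j + d it exceeds s by d + j d, hence equality at i = s -
-- 1.
factor-≥s : ∀ {s} j → 2 + j ≤ s → s ≤ (2 + j) * (s ∸ suc j)
factor-≥s j 2+j≤s with d , refl ← m≤n⇒∃[o]m+o≡n 2+j≤s = begin
  2 + j + d                              ≤⟨ m≤m+n _ (d + j * d) ⟩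
  2 + j + d + (d + j * d)                ≡⟨ expand j d ⟩
  (2 + j) * suc d                        ≡⟨ cong ((2 + j) *_) (m+n∸m≡n (suc j) (suc d)) ⟨
  (2 + j) * (suc j + suc d ∸ suc j)      ≡⟨ cong (λ z → (2 + j) * (z ∸ suc j)) (+-suc (suc j) d) ⟩
  (2 + j) * (2 + j + d ∸ suc j)          ∎
  where
  open ≤-Reasoning
  expand : ∀ j d → 2 + j + d + (d + j * d) ≡ (2 + j) * suc d
  expand = solve-∀

-- With s = 3 + j + d the right side exceeds the left by j + d + 2 j d - 1, and 4 ≤ s says that j +
-- d ≥ 1. For s = 3 the middle factor 2 * 2 would be below 9 / 2.
factor-≥³⁄₂s : ∀ {s} j → 4 ≤ s → 3 + j ≤ s → 3 * s ≤ 2 * ((2 + j) * (s ∸ suc j))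
factor-≥³⁄₂s j 4≤s 3+j≤s with d , refl ← m≤n⇒∃[o]m+o≡n 3+j≤s = begin
  3 * (3 + j + d)                        ≡⟨ lhs j d ⟩
  8 + 3 * j + 3 * d + 1                  ≤⟨ +-mono-≤ (≤-refl {8 + 3 * j + 3 * d}) (≤-trans (+-cancelˡ-≤ 3 1 (j + d) 4≤s) (m≤m+n (j + d) (2 * (j * d)))) ⟩
  8 + 3 * j + 3 * d + (j + d + 2 * (j * d)) ≡⟨ rhs j d ⟩
  2 * ((2 + j) * (2 + d))                ≡⟨ cong (λ z → 2 * ((2 + j) * z)) (m+n∸m≡n (suc j) (2 + d)) ⟨
  2 * ((2 + j) * (suc j + (2 + d) ∸ suc j)) ≡⟨ cong (λ z → 2 * ((2 + j) * (z ∸ suc j))) (shift-2 j d) ⟩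
  2 * ((2 + j) * (3 + j + d ∸ suc j))    ∎
  where
  open ≤-Reasoning
  lhs : ∀ j d → 3 * (3 + j + d) ≡ 8 + 3 * j + 3 * d + 1
  lhs = solve-∀
  rhs : ∀ j d → 8 + 3 * j + 3 * d + (j + d + 2 * (j * d)) ≡ 2 * ((2 + j) * (2 + d))
  rhs = solve-∀
  shift-2 : ∀ j d → suc j + (2 + d) ≡ 3 + j + d
  shift-2 = solve-∀

!*fall-suc : ∀ s j → (2 + j) ! * fall s (2 + j) ≡ (2 + j) * (s ∸ suc j) * ((1 + j) ! * fall s (1 + j))
!*fall-suc s j = ≡.trans (cong ((2 + j) ! *_) (fall-suc s (suc j)))
  (interchange (2 + j) ((1 + j) !) (s ∸ suc j) _)

-- The products below consist of the factors (i + 1) (s - i).  All of them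
-- are at least s, and at least 3 s / 2 except for i = 0 and i = s - 1.
!*fall-≥ : ∀ {s} j → 4 ≤ s → 2 + j ≤ s → s * (3 * s) ^ j ≤ 2 ^ j * ((1 + j) ! * fall s (1 + j))
!*fall-≥ {s} zero    _   _     = ≤-reflexive (base s)
  where
  base : ∀ s → s * 1 ≡ 1 * (1 * (s * 1))
  base = solve-∀
!*fall-≥ {s} (suc j) 4≤s 3+j≤s = begin
  s * (3 * s * (3 * s) ^ j)
    ≡⟨ x∙yz≈y∙xz s (3 * s) _ ⟩
  3 * s * (s * (3 * s) ^ j)
    ≤⟨ *-mono-≤ (factor-≥³⁄₂s j 4≤s 3+j≤s) (!*fall-≥ j 4≤s (<⇒≤ 3+j≤s)) ⟩
  2 * ((2 + j) * (s ∸ suc j)) * (2 ^ j * ((1 + j) ! * fall s (1 + j)))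
    ≡⟨ interchange 2 ((2 + j) * (s ∸ suc j)) (2 ^ j) _ ⟩
  2 * 2 ^ j * ((2 + j) * (s ∸ suc j) * ((1 + j) ! * fall s (1 + j)))
    ≡⟨ cong (2 * 2 ^ j *_) (!*fall-suc s j) ⟨
  2 * 2 ^ j * ((2 + j) ! * fall s (2 + j)) ∎
  where
  open ≤-Reasoning

-- The last factor may be the one with i = s - 1, so it contributes only s. The leading `s` on the
-- left is the spare power that becomes 1 / s in the increments.
!*fall-≥′ : ∀ {s} j → 4 ≤ s → 2 + j ≤ s → s * (3 ^ j * s ^ suc j) ≤ 2 ^ j * ((2 + j) ! * fall s (2 + j))
!*fall-≥′ {s} j 4≤s 2+j≤s = begin
  s * (3 ^ j * (s * s ^ j))
    ≡⟨ regroup s (3 ^ j) (s ^ j) ⟩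
  s * (s * (3 ^ j * s ^ j))
    ≡⟨ cong (λ z → s * (s * z)) (*-^ 3 s j) ⟨
  s * (s * (3 * s) ^ j)
    ≤⟨ *-mono-≤ (factor-≥s j 2+j≤s) (!*fall-≥ j 4≤s 2+j≤s) ⟩
  (2 + j) * (s ∸ suc j) * (2 ^ j * ((1 + j) ! * fall s (1 + j)))
    ≡⟨ x∙yz≈y∙xz ((2 + j) * (s ∸ suc j)) (2 ^ j) _ ⟩
  2 ^ j * ((2 + j) * (s ∸ suc j) * ((1 + j) ! * fall s (1 + j)))
    ≡⟨ cong (2 ^ j *_) (!*fall-suc s j) ⟨
  2 ^ j * ((2 + j) ! * fall s (2 + j)) ∎
  where
  open ≤-Reasoning
  regroup : ∀ a b c → a * (b * (a * c)) ≡ a * (a * (b * c))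
  regroup = solve-∀

-- Mean weight over random permutations

module Weight {n s : ℕ} (4≤n : 4 ≤ n) (n≤s : n ≤ s) where

  -- weight j / fall s n is the ratio between the probability that two perfect
  -- matchings with j common edges are both rainbow and its value if the two
  -- events were independent.
  weight : ℕ → ℕ
  weight j = s ^ j * fall (s ∸ j) (n ∸ j)

  increment : ℕ → ℕ
  increment j = j * (s ^ j * fall (s ∸ suc j) (n ∸ suc j))

  -- One factor s is split as (s ∸ j) + j. The part s ∸ j is the leading factor of the falling
  -- factorial in `weight j`; the part j gives the increment.
  weight-suc : ∀ {j} → j < n → weight (suc j) ≡ weight j + increment j
  weight-suc {j} j<n = begin
    s * s ^ j * f
      ≡⟨ cong (λ z → z * s ^ j * f) (m∸n+n≡m (≤-trans (<⇒≤ j<n) n≤s)) ⟨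
    (s ∸ j + j) * s ^ j * f
      ≡⟨ distribute (s ∸ j) j (s ^ j) f ⟩
    s ^ j * ((s ∸ j) * f) + increment j
      ≡⟨ cong (λ z → s ^ j * ((s ∸ j) * fall z (n ∸ suc j)) + increment j) (∸-suc s j) ⟨
    s ^ j * fall (s ∸ j) (suc (n ∸ suc j)) + increment j
      ≡⟨ cong (λ z → s ^ j * fall (s ∸ j) z + increment j) (+-∸-assoc 1 j<n) ⟨
    weight j + increment j ∎
    where
    open ≡-Reasoning
    f = fall (s ∸ suc j) (n ∸ suc j)
    ∸-suc : ∀ s j → s ∸ j ∸ 1 ≡ s ∸ suc j
    ∸-suc s j = ≡.trans (∸-+-assoc s j 1) (cong (s ∸_) (+-comm j 1))
    distribute : ∀ a b c d → (a + b) * c * d ≡ c * (a * d) + b * (c * d)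
    distribute = solve-∀

  -- Since [s]ₙ = [s]ⱼ₊₂ [s - j - 2]ₙ₋ⱼ₋₂, the tail `f` is common to both sides and `!*fall-≥′`
  -- decides. The factor `(2 + j) !` is left for the bound on the probability of 2 + j agreements to
  -- absorb.
  increment-≤ : ∀ j → suc j < n →
    n * (3 ^ j * increment (suc j)) ≤ suc j * (2 ^ j * ((2 + j) ! * fall s n))
  increment-≤ j 1+j<n = begin
    n * (3 ^ j * (suc j * (s ^ suc j * f)))
      ≤⟨ *-monoˡ-≤ _ n≤s ⟩
    s * (3 ^ j * (suc j * (s ^ suc j * f)))
      ≡⟨ regroup s (3 ^ j) (suc j) (s ^ suc j) f ⟩
    suc j * (s * (3 ^ j * s ^ suc j) * f)
      ≤⟨ *-monoʳ-≤ (suc j) (*-monoˡ-≤ f (!*fall-≥′ j (≤-trans 4≤n n≤s) (≤-trans 1+j<n n≤s))) ⟩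
    suc j * (2 ^ j * ((2 + j) ! * fall s (2 + j)) * f)
      ≡⟨ cong (suc j *_) (reassoc (2 ^ j) ((2 + j) !) _ f) ⟩
    suc j * (2 ^ j * ((2 + j) ! * (fall s (2 + j) * f)))
      ≡⟨ cong (λ z → suc j * (2 ^ j * ((2 + j) ! * z))) (≡.trans (sym (fall-+ s (2 + j) (n ∸ (2 + j)))) (cong (fall s) (m+[n∸m]≡n 1+j<n))) ⟩
    suc j * (2 ^ j * ((2 + j) ! * fall s n)) ∎
    where
    open ≤-Reasoning
    f = fall (s ∸ (2 + j)) (n ∸ (2 + j))
    regroup : ∀ a b c d e → a * (b * (c * (d * e))) ≡ c * (a * (b * d) * e)
    regroup = solve-∀
    reassoc : ∀ a b c d → a * (b * c) * d ≡ a * (b * (c * d))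
    reassoc = solve-∀

  module _ (σ : Fin n → Fin n) (σ-perm : distinct (map σ (allFin n)) ≡ 1) where

    -- Capping the number of agreements turns summation by parts into an induction on the cap:
    -- raising it from m to m + 1 adds `increment m` exactly where there are more than m agreements.
    truncated : ℕ → ℕ
    truncated m = ∑ⱽ λ τ → isPerm τ * weight (agreements σ τ ⊓ m)

    truncated-suc : ∀ {m} → m < n → truncated (suc m) ≡
      truncated m + increment m * ∑ⱽ (λ τ → isPerm τ * ⟦ suc m ≤? agreements σ τ ⟧)
    truncated-suc {m} m<n = begin
      ∑ⱽ (λ τ → isPerm τ * weight (agreements σ τ ⊓ suc m))
        ≡⟨ sum-cong-≗ {n ^ n} (λ i → pointwise (vec i)) ⟩
      ∑ⱽ (λ τ → isPerm τ * weight (agreements σ τ ⊓ m) + increment m * (isPerm τ * ⟦ suc m ≤? agreements σ τ ⟧))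
        ≡⟨ ∑-distrib-+ {n ^ n} (λ i → isPerm {n} (vec i) * weight (agreements σ (vec i) ⊓ m)) (λ i → increment m * (isPerm {n} (vec i) * ⟦ suc m ≤? agreements σ (vec i) ⟧)) ⟩
      truncated m + ∑ⱽ (λ τ → increment m * (isPerm τ * ⟦ suc m ≤? agreements σ τ ⟧))
        ≡⟨ cong (truncated m +_) (*-distribˡ-sum {n ^ n} (increment m) (λ i → isPerm {n} (vec i) * ⟦ suc m ≤? agreements σ (vec i) ⟧)) ⟨
      truncated m + increment m * ∑ⱽ (λ τ → isPerm τ * ⟦ suc m ≤? agreements σ τ ⟧) ∎
      where
      open ≡-Reasoning
      weight-⊓ : ∀ F (m<F? : Dec (suc m ≤ F)) → weight (F ⊓ suc m) ≡ weight (F ⊓ m) + increment m * ⟦ m<F? ⟧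
      weight-⊓ F (yes m<F) = begin
        weight (F ⊓ suc m)                ≡⟨ cong weight (m≥n⇒m⊓n≡n m<F) ⟩
        weight (suc m)                    ≡⟨ weight-suc m<n ⟩
        weight m + increment m            ≡⟨ cong₂ (λ a b → weight a + b) (m≥n⇒m⊓n≡n (<⇒≤ m<F)) (*-identityʳ (increment m)) ⟨
        weight (F ⊓ m) + increment m * 1  ∎
      weight-⊓ F (no m≮F) = begin
        weight (F ⊓ suc m)                ≡⟨ cong weight (≡.trans (m≤n⇒m⊓n≡m (m≤n⇒m≤1+n F≤m)) (sym (m≤n⇒m⊓n≡m F≤m))) ⟩
        weight (F ⊓ m)                    ≡⟨ +-identityʳ _ ⟨
        weight (F ⊓ m) + 0                ≡⟨ cong (weight (F ⊓ m) +_) (*-zeroʳ (increment m)) ⟨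
        weight (F ⊓ m) + increment m * 0  ∎
        where F≤m = ≮⇒≥ m≮F
      distribute : ∀ a b c d → a * (b + c * d) ≡ a * b + c * (a * d)
      distribute = solve-∀
      pointwise : ∀ τ → isPerm τ * weight (agreements σ τ ⊓ suc m) ≡
        isPerm τ * weight (agreements σ τ ⊓ m) + increment m * (isPerm τ * ⟦ suc m ≤? agreements σ τ ⟧)
      pointwise τ = ≡.trans
        (cong (isPerm τ *_) (weight-⊓ (agreements σ τ) (suc m ≤? agreements σ τ)))
        (distribute (isPerm τ) _ (increment m) ⟦ suc m ≤? agreements σ τ ⟧)

    Q : ℕ
    Q = n ! * fall s n

    truncated-1 : truncated 1 ≡ Q
    truncated-1 = begin
      truncated 1                             ≡⟨ truncated-suc (<-trans (s≤s z≤n) 4≤n) ⟩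
      -- `increment 0` computes to 0, which is g(0) = g(1).
      truncated 0 + 0                         ≡⟨ +-identityʳ _ ⟩
      truncated 0                             ≡⟨ sum-cong-≗ {n ^ n} (λ i → cong (λ z → isPerm {n} (vec i) * weight z) (⊓-zeroʳ (agreements σ (vec i)))) ⟩
      ∑ⱽ {n} {n} (λ τ → isPerm τ * weight 0)          ≡⟨ *-distribʳ-sum {n ^ n} (weight 0) (λ i → isPerm {n} (vec i)) ⟨
      ∑ⱽ (isPerm {n}) * (1 * fall s n)        ≡⟨ cong₂ _*_ (∑ⱽ-isPerm n) (*-identityˡ (fall s n)) ⟩
      Q                                       ∎
      where open ≡-Reasoning

    -- The second summand is the tail ∑_{j > a} of the series
    -- ∑_{j ≥ 1} j (2/3)ʲ⁻¹ = 9, scaled by 3ᵃ Q.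
    truncated-≤ : ∀ a → a < n →
      n * (3 ^ a * truncated (suc a)) + 3 * (2 ^ a * (3 + a) * Q) ≤ (n + 9) * (3 ^ a * Q)
    truncated-≤ zero    _     = ≤-reflexive (≡.trans (cong (λ z → n * (1 * z) + 3 * (3 * Q)) truncated-1) (base n Q))
      where
      base : ∀ n q → n * (1 * q) + 3 * (3 * q) ≡ (n + 9) * (1 * q)
      base = solve-∀
    truncated-≤ (suc a) 1+a<n = begin
      n * (3 ^ suc a * truncated (2 + a)) + 3 * (2 ^ suc a * (4 + a) * Q)
        ≡⟨ cong (λ z → n * (3 ^ suc a * z) + 3 * (2 ^ suc a * (4 + a) * Q)) (truncated-suc 1+a<n) ⟩
      n * (3 * 3 ^ a * (truncated (suc a) + increment (suc a) * M)) + 3 * (2 * 2 ^ a * (4 + a) * Q)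
        ≡⟨ regroup n (3 ^ a) (truncated (suc a)) (increment (suc a)) M (2 ^ a) (4 + a) Q ⟩
      3 * (n * (3 ^ a * truncated (suc a)) + n * (3 ^ a * increment (suc a)) * M + 2 * (2 ^ a * (4 + a) * Q))
        ≤⟨ *-monoʳ-≤ 3 (+-monoˡ-≤ (2 * (2 ^ a * (4 + a) * Q)) (+-monoʳ-≤ (n * (3 ^ a * truncated (suc a))) gain)) ⟩
      3 * (n * (3 ^ a * truncated (suc a)) + suc a * (2 ^ a * Q) + 2 * (2 ^ a * (4 + a) * Q))
        -- The recursion of the tails: (a + 1) + 2 (a + 4) = 3 (a + 3).
        ≡⟨ collect (n * (3 ^ a * truncated (suc a))) a (2 ^ a) Q ⟩
      3 * (n * (3 ^ a * truncated (suc a)) + 3 * (2 ^ a * (3 + a) * Q))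
        ≤⟨ *-monoʳ-≤ 3 (truncated-≤ a (<⇒≤ 1+a<n)) ⟩
      3 * ((n + 9) * (3 ^ a * Q))
        ≡⟨ swapFactors 3 (n + 9) (3 ^ a) Q ⟩
      (n + 9) * (3 ^ suc a * Q) ∎
      where
      open ≤-Reasoning
      M : ℕ
      M = ∑ⱽ λ τ → isPerm τ * ⟦ 2 + a ≤? agreements σ τ ⟧
      gain : n * (3 ^ a * increment (suc a)) * M ≤ suc a * (2 ^ a * Q)
      gain = begin
        n * (3 ^ a * increment (suc a)) * M                 ≤⟨ *-monoˡ-≤ M (increment-≤ a 1+a<n) ⟩
        suc a * (2 ^ a * ((2 + a) ! * fall s n)) * M        ≡⟨ shuffle (suc a) (2 ^ a) ((2 + a) !) (fall s n) M ⟩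
        suc a * (2 ^ a * (M * (2 + a) ! * fall s n))        ≤⟨ *-monoʳ-≤ (suc a) (*-monoʳ-≤ (2 ^ a) (*-monoˡ-≤ (fall s n) (∑ⱽ-perm-agreements≥ σ σ-perm (2 + a)))) ⟩
        suc a * (2 ^ a * Q)                                 ∎
        where
        shuffle : ∀ a b c d e → a * (b * (c * d)) * e ≡ a * (b * (e * c * d))
        shuffle = solve-∀
      regroup : ∀ n t u i m b c q → n * (3 * t * (u + i * m)) + 3 * (2 * b * c * q) ≡
        3 * (n * (t * u) + n * (t * i) * m + 2 * (b * c * q))
      regroup = solve-∀
      collect : ∀ u a b q → 3 * (u + suc a * (b * q) + 2 * (b * (4 + a) * q)) ≡ 3 * (u + 3 * (b * (3 + a) * q))
      collect = solve-∀
      swapFactors : ∀ a b c d → a * (b * (c * d)) ≡ b * (a * c * d)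
      swapFactors = solve-∀

    ∑ⱽ-weight : n * ∑ⱽ (λ τ → isPerm τ * weight (agreements σ τ)) ≤ (n + 9) * (n ! * fall s n)
    ∑ⱽ-weight = *-cancelˡ-≤ (3 ^ pred n) {{m^n≢0 3 (pred n)}} (begin
      3 ^ pred n * (n * ∑ⱽ (λ τ → isPerm τ * weight (agreements σ τ)))
        ≡⟨ cong (λ z → 3 ^ pred n * (n * z)) (sum-cong-≗ {n ^ n} (λ i → cong (λ z → isPerm {n} (vec i) * weight z) (sym (m≤n⇒m⊓n≡m (F≤n (vec i)))))) ⟩
      3 ^ pred n * (n * truncated n)
        ≡⟨ cong (λ z → 3 ^ pred n * (n * truncated z)) (suc-pred n) ⟨
      3 ^ pred n * (n * truncated (suc (pred n)))
        ≡⟨ x∙yz≈y∙xz (3 ^ pred n) n _ ⟩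
      n * (3 ^ pred n * truncated (suc (pred n)))
        -- The summand added here is the tail of the series beyond the cap; the induction bounds the
        -- sum with it.
        ≤⟨ m≤m+n _ _ ⟩
      n * (3 ^ pred n * truncated (suc (pred n))) + 3 * (2 ^ pred n * (3 + pred n) * Q)
        ≤⟨ truncated-≤ (pred n) (≤-reflexive (suc-pred n)) ⟩
      (n + 9) * (3 ^ pred n * Q)
        ≡⟨ x∙yz≈y∙xz (n + 9) (3 ^ pred n) Q ⟩
      3 ^ pred n * ((n + 9) * Q) ∎)
      where
      open ≤-Reasoning
      instance
        n≢0 : NonZero n
        n≢0 = >-nonZero (<-trans (s≤s z≤n) 4≤n)
      F≤n : ∀ τ → agreements σ τ ≤ n
      F≤n τ = ≤-trans (sum-mono-≤ (λ x → ⟦⟧≤1 (lookup τ x ≟ σ x))) (≤-reflexive (≡.trans (sum-const n 1) (*-identityʳ n)))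

-- Perfect matchings as permutations, and pairs of them

filter-complement-↭ : {P : Pred A p} (P? : Decidable P) (l : List A) →
  filter (∁? P?) l ++ filter P? l ↭ l
filter-complement-↭ P? []      = refl
filter-complement-↭ P? (x ∷ l) with P? x
... | yes _ = ↭-trans (shift x (filter (∁? P?) l) (filter P? l)) (prep x (filter-complement-↭ P? l))
... | no  _ = prep x (filter-complement-↭ P? l)

length-filter-tabulate : {P : Pred A p} (P? : Decidable P) (f : Fin n → A) →
  length (filter P? (List.tabulate f)) ≡ (∑[ i < n ] ⟦ P? (f i) ⟧)
length-filter-tabulate {n = zero}  P? f = refl
length-filter-tabulate {n = suc n} P? f with P? (f zero)
... | yes _ = cong suc (length-filter-tabulate P? (f ∘ suc))
... | no  _ = length-filter-tabulate P? (f ∘ suc)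

matchingEdge : Vec (Fin n) n → Fin n → Edge n
matchingEdge σ i = combine i (lookup σ i)

matchingEdge-injective : (σ : Vec (Fin n) n) → Injective _≡_ _≡_ (matchingEdge σ)
matchingEdge-injective σ = proj₁ ∘ combine-injective _ _ _ _

isRainbow : Vec (Fin k) (n * n) → Vec (Fin n) n → ℕ
isRainbow {n = n} c σ = distinct (at c (map (matchingEdge σ) (allFin n)))

distinct-matching : (σ : Vec (Fin n) n) {l : List (Fin n)} → l ↭ allFin n →
  distinct (map (matchingEdge σ) l) ≡ 1
distinct-matching {n} σ {l} p = ≡.trans (distinct-map (matchingEdge-injective σ) l)
  (≡.trans (distinct-↭ p) (distinct-allFin n))

∑ⱽ-isRainbow : (σ : Vec (Fin n) n) →
  k ^ n * ∑ⱽ {k} (λ c → isRainbow c σ) ≡ fall k n * k ^ (n * n)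
∑ⱽ-isRainbow {n} {k} σ = subst
  (λ l → k ^ l * ∑ⱽ {k} (λ c → isRainbow c σ) ≡ fall k l * k ^ (n * n))
  (≡.trans (length-map (matchingEdge σ) (allFin n)) (length-allFin n))
  (∑ⱽ-distinct (map (matchingEdge σ) (allFin n)) (distinct-matching σ refl))

module Pair (σ τ : Vec (Fin n) n) where

  private
    same? : Decidable (λ i → lookup τ i ≡ lookup σ i)
    same? i = lookup τ i ≟ lookup σ i
    F = agreements (lookup σ) τ
    -- `z` holds the rows where τ leaves σ, `j` those of the common edges; their edges are the two
    -- lists for `distinct-peel`.
    z = filter (∁? same?) (allFin n)
    j = filter same? (allFin n)

    z++j↭ : z ++ j ↭ allFin n
    z++j↭ = filter-complement-↭ same? (allFin n)

    |j| : length j ≡ F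
    |j| = length-filter-tabulate same? id

    |z|+|j| : length z + length j ≡ n
    |z|+|j| = ≡.trans (sym (length-++ z)) (≡.trans (↭-length z++j↭) (length-allFin n))

    |z| : length z ≡ n ∸ F
    |z| = ≡.trans (sym (m+n∸n≡m _ (length j))) (cong₂ _∸_ |z|+|j| |j|)

    map-same : ∀ {l} → All (λ i → lookup τ i ≡ lookup σ i) l →
      map (matchingEdge τ) l ≡ map (matchingEdge σ) l
    map-same []                = refl
    map-same (_∷_ {i} eq eqs) = cong₂ _∷_ (cong (combine i) eq) (map-same eqs)

    edges-τ : map (matchingEdge τ) (z ++ j) ≡ map (matchingEdge τ) z ++ map (matchingEdge σ) j
    edges-τ = ≡.trans (map-++ (matchingEdge τ) z j)
      (cong (map (matchingEdge τ) z ++_) (map-same (all-filter same? (allFin n))))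

    ignored : All (λ e → Ignores {k = k} e (λ c → isRainbow c σ)) (map (matchingEdge τ) z)
    ignored = All-map⁺ (All.map ignores (all-filter (∁? same?) (allFin n)))
      where
      ignores : ∀ {i} → lookup τ i ≢ lookup σ i → Ignores (matchingEdge τ i) (λ c → isRainbow c σ)
      ignores {i} τi≢σi c x = cong distinct (at-ignores (map (matchingEdge σ) (allFin n))
        (fresh-map (matchingEdge σ) (allFin n) differ) c x)
        where
        -- An edge of σ equal to this one would lie in the same row i, where the two matchings
        -- differ.
        differ : ∀ y → matchingEdge τ i ≢ matchingEdge σ y
        differ y eq with refl , τi≡σi ← combine-injective i (lookup τ i) y (lookup σ y) eq = τi≢σi τi≡σi

    absorb : (c : Vec (Fin k) (n * n)) → isRainbow c σ * distinct (at c (map (matchingEdge σ) j)) ≡ isRainbow c σ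
    absorb c with ≤1-dichotomy (distinct≤1 (at c (map (matchingEdge σ) (allFin n))))
    ... | inj₁ ≡0 rewrite ≡0 = refl
    ... | inj₂ ≡1 = ≡.trans (cong (isRainbow c σ *_) (distinct-++ʳ (at c (map (matchingEdge σ) z)) _ split)) (*-identityʳ _)
      where
      split : distinct (at c (map (matchingEdge σ) z) ++ at c (map (matchingEdge σ) j)) ≡ 1
      split = begin
        distinct (at c (map (matchingEdge σ) z) ++ at c (map (matchingEdge σ) j)) ≡⟨ cong distinct (map-++ (lookup c) (map (matchingEdge σ) z) _) ⟨
        distinct (at c (map (matchingEdge σ) z ++ map (matchingEdge σ) j)) ≡⟨ cong (distinct ∘ at c) (map-++ (matchingEdge σ) z j) ⟨
        distinct (at c (map (matchingEdge σ) (z ++ j)))                    ≡⟨ distinct-↭ (map⁺ (lookup c) (map⁺ (matchingEdge σ) z++j↭)) ⟩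
        isRainbow c σ                                                      ≡⟨ ≡1 ⟩
        1                                                                  ∎
        where open ≡-Reasoning

  F≤n : F ≤ n
  F≤n = subst₂ _≤_ |j| |z|+|j| (m≤n+m (length j) (length z))

  ∑ⱽ-both-rainbow : k ^ (n ∸ F) * ∑ⱽ {k} (λ c → isRainbow c σ * isRainbow c τ) ≡
    fall (k ∸ F) (n ∸ F) * ∑ⱽ {k} (λ c → isRainbow c σ)
  ∑ⱽ-both-rainbow {k} = begin
    k ^ (n ∸ F) * ∑ⱽ {k} (λ c → isRainbow c σ * isRainbow c τ)
      ≡⟨ cong₂ _*_ (cong (k ^_) (≡.trans (sym |z|) (sym (length-map (matchingEdge τ) z)))) (sum-cong-≗ {k ^ (n * n)} (λ i → cong (isRainbow (vec i) σ *_) (reorder (vec i)))) ⟩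
    k ^ length z′ * ∑ⱽ {k} (λ c → isRainbow c σ * distinct (at c (z′ ++ j′)))
      ≡⟨ distinct-peel z′ j′ (λ c → isRainbow c σ) (≡.trans (cong distinct (sym edges-τ)) (distinct-matching τ z++j↭)) ignored absorb ⟩
    fall (k ∸ length j′) (length z′) * ∑ⱽ {k} (λ c → isRainbow c σ)
      ≡⟨ cong₂ (λ a b → fall (k ∸ a) b * ∑ⱽ {k} (λ c → isRainbow c σ)) (≡.trans (length-map (matchingEdge σ) j) |j|) (≡.trans (length-map (matchingEdge τ) z) |z|) ⟩
    fall (k ∸ F) (n ∸ F) * ∑ⱽ {k} (λ c → isRainbow c σ) ∎
    where
    open ≡-Reasoning
    z′ = map (matchingEdge τ) z
    j′ = map (matchingEdge σ) j
    reorder : (c : Vec (Fin k) (n * n)) → isRainbow c τ ≡ distinct (at c (z′ ++ j′))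
    reorder c = ≡.trans (distinct-↭ (map⁺ (lookup c) (map⁺ (matchingEdge τ) (↭-sym z++j↭)))) (cong (distinct ∘ at c) edges-τ)

-- First and second moment of the number of rainbow perfect matchings

∑ⱽ-comm : ∀ {k′ m′} (f : Vec (Fin k) m → Vec (Fin k′) m′ → ℕ) →
  ∑ⱽ (λ c → ∑ⱽ (f c)) ≡ ∑ⱽ (λ d → ∑ⱽ (λ c → f c d))
∑ⱽ-comm {k} {m} {k′} {m′} f = ∑-comm {k ^ m} {k′ ^ m′} (λ i j → f (vec i) (vec j))

∑ⱽ-cong : {f g : Vec (Fin k) m → ℕ} → (∀ c → f c ≡ g c) → ∑ⱽ f ≡ ∑ⱽ g
∑ⱽ-cong f≗g = sum-cong-≗ (f≗g ∘ vec)

*-distribˡ-∑ⱽ : ∀ x (f : Vec (Fin k) m → ℕ) → x * ∑ⱽ f ≡ ∑ⱽ (λ c → x * f c)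
*-distribˡ-∑ⱽ x f = *-distribˡ-sum x (f ∘ vec)

*-distribʳ-∑ⱽ : ∀ x (f : Vec (Fin k) m → ℕ) → ∑ⱽ f * x ≡ ∑ⱽ (λ c → f c * x)
*-distribʳ-∑ⱽ x f = *-distribʳ-sum x (f ∘ vec)

module Moments (n s : ℕ) where

  private
    T = s ^ (n * n)

    ∑σ : (Vec (Fin n) n → ℕ) → ℕ
    ∑σ = ∑ⱽ

    ∑c : (Vec (Fin s) (n * n) → ℕ) → ℕ
    ∑c = ∑ⱽ

  matchingCount : Vec (Fin s) (n * n) → ℕ
  matchingCount c = ∑σ λ σ → isPerm σ * isRainbow c σ

  first-moment :
    s ^ n * ∑c matchingCount ≡ n ! * (fall s n * s ^ (n * n))
  first-moment = begin
    s ^ n * ∑c matchingCount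
      ≡⟨ cong (s ^ n *_) (∑ⱽ-comm {s} {n * n} {n} {n} (λ c σ → isPerm σ * isRainbow c σ)) ⟩
    s ^ n * ∑σ (λ σ → ∑c (λ c → isPerm σ * isRainbow c σ))
      ≡⟨ *-distribˡ-∑ⱽ {n} {n} (s ^ n) (λ σ → ∑c (λ c → isPerm σ * isRainbow c σ)) ⟩
    ∑σ (λ σ → s ^ n * ∑c (λ c → isPerm σ * isRainbow c σ))
      ≡⟨ ∑ⱽ-cong {n} {n} (λ σ → ≡.trans (cong (s ^ n *_) (sym (*-distribˡ-∑ⱽ {s} {n * n} (isPerm σ) (λ c → isRainbow c σ))))
           (≡.trans (x∙yz≈y∙xz (s ^ n) (isPerm σ) _) (cong (isPerm σ *_) (∑ⱽ-isRainbow σ)))) ⟩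
    ∑σ (λ σ → isPerm σ * (fall s n * s ^ (n * n)))
      ≡⟨ *-distribʳ-∑ⱽ {n} {n} (fall s n * s ^ (n * n)) isPerm ⟨
    ∑σ isPerm * (fall s n * s ^ (n * n))
      ≡⟨ cong (_* (fall s n * s ^ (n * n))) (∑ⱽ-isPerm n) ⟩
    n ! * (fall s n * s ^ (n * n)) ∎
    where
    open ≡-Reasoning

  both : Vec (Fin n) n → Vec (Fin n) n → ℕ
  both σ τ = ∑c (λ c → isRainbow c σ * isRainbow c τ)

  square : ∑c (λ c → matchingCount c * matchingCount c) ≡
    ∑σ (λ σ → isPerm σ * ∑σ (λ τ → isPerm τ * both σ τ))
  square = begin
    ∑c (λ c → matchingCount c * matchingCount c)
      ≡⟨ ∑ⱽ-cong {s} {n * n} (λ c → ≡.trans (*-distribʳ-∑ⱽ {n} {n} (matchingCount c) (λ σ → isPerm σ * isRainbow c σ))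
           (∑ⱽ-cong {n} {n} (λ σ → ≡.trans (*-distribˡ-∑ⱽ {n} {n} (isPerm σ * isRainbow c σ) (λ τ → isPerm τ * isRainbow c τ))
             (≡.trans (∑ⱽ-cong {n} {n} (λ τ → regroup (isPerm σ) (isRainbow c σ) (isPerm τ) (isRainbow c τ))) (sym (*-distribˡ-∑ⱽ {n} {n} (isPerm σ) (λ τ → isPerm τ * (isRainbow c σ * isRainbow c τ)))))))) ⟩
    ∑c (λ c → ∑σ (λ σ → isPerm σ * ∑σ (λ τ → isPerm τ * (isRainbow c σ * isRainbow c τ))))
      ≡⟨ ∑ⱽ-comm {s} {n * n} {n} {n} (λ c σ → isPerm σ * ∑σ (λ τ → isPerm τ * (isRainbow c σ * isRainbow c τ))) ⟩
    ∑σ (λ σ → ∑c (λ c → isPerm σ * ∑σ (λ τ → isPerm τ * (isRainbow c σ * isRainbow c τ))))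
      ≡⟨ ∑ⱽ-cong {n} {n} (λ σ → ≡.trans (sym (*-distribˡ-∑ⱽ {s} {n * n} (isPerm σ) (λ c → ∑σ (λ τ → isPerm τ * (isRainbow c σ * isRainbow c τ)))))
           (cong (isPerm σ *_) (≡.trans (∑ⱽ-comm {s} {n * n} {n} {n} (λ c τ → isPerm τ * (isRainbow c σ * isRainbow c τ)))
             (∑ⱽ-cong {n} {n} (λ τ → sym (*-distribˡ-∑ⱽ {s} {n * n} (isPerm τ) (λ c → isRainbow c σ * isRainbow c τ))))))) ⟩
    ∑σ (λ σ → isPerm σ * ∑σ (λ τ → isPerm τ * both σ τ)) ∎
    where
    open ≡-Reasoning
    regroup : ∀ a b c d → a * b * (c * d) ≡ a * (c * (b * d))
    regroup = solve-∀

  module _ (4≤n : 4 ≤ n) (n≤s : n ≤ s) where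
    open Weight 4≤n n≤s

    -- One power s ^ n clears the denominator of `∑ⱽ-isRainbow`. The other is split as s ^ F * s ^
    -- (n ∸ F): the second factor clears `∑ⱽ-both-rainbow`, the first completes the weight.
    both-weight : ∀ σ τ → s ^ n * (s ^ n * both σ τ) ≡ weight (agreements (lookup σ) τ) * (fall s n * T)
    both-weight σ τ = begin
      s ^ n * (s ^ n * both σ τ)
        ≡⟨ cong (λ z → s ^ n * (z * both σ τ)) (≡.trans (cong (s ^_) (sym (m+[n∸m]≡n F≤n))) (^-distribˡ-+-* s F (n ∸ F))) ⟩
      s ^ n * (s ^ F * s ^ (n ∸ F) * both σ τ)
        ≡⟨ regroup (s ^ n) (s ^ F) (s ^ (n ∸ F)) (both σ τ) ⟩
      s ^ F * (s ^ n * (s ^ (n ∸ F) * both σ τ))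
        ≡⟨ cong (λ z → s ^ F * (s ^ n * z)) ∑ⱽ-both-rainbow ⟩
      s ^ F * (s ^ n * (fall (s ∸ F) (n ∸ F) * R))
        ≡⟨ regroup′ (s ^ F) (s ^ n) (fall (s ∸ F) (n ∸ F)) R ⟩
      weight F * (s ^ n * R)
        ≡⟨ cong (weight F *_) (∑ⱽ-isRainbow σ) ⟩
      weight F * (fall s n * T) ∎
      where
      open ≡-Reasoning
      open Pair σ τ
      F = agreements (lookup σ) τ
      R = ∑c (λ c → isRainbow c σ)
      regroup : ∀ a b c d → a * (b * c * d) ≡ b * (a * (c * d))
      regroup = solve-∀
      regroup′ : ∀ a b c d → a * (b * (c * d)) ≡ a * c * (b * d)
      regroup′ = solve-∀

    -- E[X²] ≤ (1 + 9 / n) E[X]² with denominators cleared. `∑ⱽ-weight` bounds the sum over τ for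
    -- every single permutation σ, hence also after summing over σ.
    second-moment : n * (s ^ n * (s ^ n * ∑c (λ c → matchingCount c * matchingCount c))) ≤
      n ! * ((n + 9) * (n ! * fall s n) * (fall s n * T))
    second-moment = begin
      n * (s ^ n * (s ^ n * ∑c (λ c → matchingCount c * matchingCount c)))
        ≡⟨ cong (λ z → n * (s ^ n * (s ^ n * z))) square ⟩
      n * (s ^ n * (s ^ n * ∑σ (λ σ → isPerm σ * I σ)))
        ≡⟨ flatten n (s ^ n) (s ^ n) _ ⟩
      n * (s ^ n * s ^ n) * ∑σ (λ σ → isPerm σ * I σ)
        ≡⟨ *-distribˡ-∑ⱽ {n} {n} (n * (s ^ n * s ^ n)) (λ σ → isPerm σ * I σ) ⟩
      ∑σ (λ σ → n * (s ^ n * s ^ n) * (isPerm σ * I σ))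
        ≤⟨ sum-mono-≤ {n ^ n} (λ i → bound (vec i)) ⟩
      ∑σ (λ σ → isPerm σ * ((n + 9) * (n ! * fall s n) * (fall s n * T)))
        ≡⟨ *-distribʳ-∑ⱽ {n} {n} ((n + 9) * (n ! * fall s n) * (fall s n * T)) isPerm ⟨
      ∑σ isPerm * ((n + 9) * (n ! * fall s n) * (fall s n * T))
        ≡⟨ cong (_* ((n + 9) * (n ! * fall s n) * (fall s n * T))) (∑ⱽ-isPerm n) ⟩
      n ! * ((n + 9) * (n ! * fall s n) * (fall s n * T)) ∎
      where
      open ≤-Reasoning
      I : Vec (Fin n) n → ℕ
      I σ = ∑σ (λ τ → isPerm τ * both σ τ)
      flatten : ∀ a b c d → a * (b * (c * d)) ≡ a * (b * c) * d
      flatten = solve-∀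
      pull : ∀ a b c d → a * (b * b) * (c * d) ≡ c * (a * (b * b * d))
      pull = solve-∀
      inner : ∀ σ → s ^ n * s ^ n * I σ ≡ ∑σ (λ τ → isPerm τ * weight (agreements (lookup σ) τ)) * (fall s n * T)
      inner σ = begin-equality
        s ^ n * s ^ n * I σ
          ≡⟨ *-distribˡ-∑ⱽ {n} {n} (s ^ n * s ^ n) (λ τ → isPerm τ * both σ τ) ⟩
        ∑σ (λ τ → s ^ n * s ^ n * (isPerm τ * both σ τ))
          ≡⟨ ∑ⱽ-cong {n} {n} (λ τ → ≡.trans (x∙yz (s ^ n) (isPerm τ) (both σ τ)) (≡.trans (cong (isPerm τ *_) (both-weight σ τ)) (sym (*-assoc (isPerm τ) (weight (agreements (lookup σ) τ)) (fall s n * T))))) ⟩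
        ∑σ (λ τ → isPerm τ * weight (agreements (lookup σ) τ) * (fall s n * T))
          ≡⟨ *-distribʳ-∑ⱽ {n} {n} (fall s n * T) (λ τ → isPerm τ * weight (agreements (lookup σ) τ)) ⟨
        ∑σ (λ τ → isPerm τ * weight (agreements (lookup σ) τ)) * (fall s n * T) ∎
        where
        x∙yz : ∀ a b c → a * a * (b * c) ≡ b * (a * (a * c))
        x∙yz = solve-∀
      bound : ∀ σ → n * (s ^ n * s ^ n) * (isPerm σ * I σ) ≤ isPerm σ * ((n + 9) * (n ! * fall s n) * (fall s n * T))
      bound σ = ≤-trans (≤-reflexive (≡.trans (pull n (s ^ n) (isPerm σ) (I σ)) (cong (λ z → isPerm σ * (n * z)) (inner σ)))) (by (≤1-dichotomy (distinct≤1 (at σ (allFin n)))))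
        where
        W = ∑σ (λ τ → isPerm τ * weight (agreements (lookup σ) τ))
        by : isPerm σ ≡ 0 ⊎ isPerm σ ≡ 1 → isPerm σ * (n * (W * (fall s n * T))) ≤ isPerm σ * ((n + 9) * (n ! * fall s n) * (fall s n * T))
        by (inj₁ ≡0) rewrite ≡0 = z≤n
        by (inj₂ ≡1) = *-monoʳ-≤ (isPerm σ) (≤-trans (≤-reflexive (sym (*-assoc n W _))) (*-monoˡ-≤ (fall s n * T) (∑ⱽ-weight (lookup σ) ≡1)))

-- Cauchy-Schwarz inequality

2xy≤xx+yy : ∀ x y → 2 * (x * y) ≤ x * x + y * y
2xy≤xx+yy x y with ≤-total x y
... | inj₁ x≤y with d , refl ← m≤n⇒∃[o]m+o≡n x≤y = ≤-trans (m≤m+n _ (d * d)) (≤-reflexive (expand x d))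
  where
  expand : ∀ x d → 2 * (x * (x + d)) + d * d ≡ x * x + (x + d) * (x + d)
  expand = solve-∀
... | inj₂ y≤x with d , refl ← m≤n⇒∃[o]m+o≡n y≤x = ≤-trans (m≤m+n _ (d * d)) (≤-reflexive (expand y d))
  where
  expand : ∀ y d → 2 * ((y + d) * y) + d * d ≡ (y + d) * (y + d) + y * y
  expand = solve-∀

-- Cauchy-Schwarz against the indicator b of `P`, as a double sum of 2 fᵢ fⱼ ≤ bᵢ fⱼ² + fᵢ² bⱼ. If
-- `P` fails at i or at j the left side is 0; otherwise this is 2xy ≤ x² + y².
sum-cauchy-schwarz : {P : Pred (Fin n) p} (P? : Decidable P) (f : Fin n → ℕ) →
  (∀ i → ¬ P i → f i ≡ 0) →
  sum f * sum f ≤ (∑[ i < n ] ⟦ P? i ⟧) * (∑[ i < n ] (f i * f i))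
sum-cauchy-schwarz {n} P? f f≡0 = *-cancelˡ-≤ 2 (begin
  2 * (sum f * sum f)
    ≡⟨ ≡.trans (cong (2 *_) (sum-*-sum f f)) (≡.trans (*-distribˡ-sum 2 (λ i → ∑[ j < n ] (f i * f j))) (sum-cong-≗ λ i → *-distribˡ-sum 2 (λ j → f i * f j))) ⟩
  (∑[ i < n ] ∑[ j < n ] (2 * (f i * f j)))
    ≤⟨ sum-mono-≤ (λ i → sum-mono-≤ (λ j → pointwise i j (P? i) (P? j))) ⟩
  (∑[ i < n ] ∑[ j < n ] (b i * g j + g i * b j))
    ≡⟨ sum-cong-≗ (λ i → ∑-distrib-+ (λ j → b i * g j) (λ j → g i * b j)) ⟩
  (∑[ i < n ] ((∑[ j < n ] (b i * g j)) + (∑[ j < n ] (g i * b j))))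
    ≡⟨ ∑-distrib-+ (λ i → ∑[ j < n ] (b i * g j)) (λ i → ∑[ j < n ] (g i * b j)) ⟩
  (∑[ i < n ] ∑[ j < n ] (b i * g j)) + (∑[ i < n ] ∑[ j < n ] (g i * b j))
    ≡⟨ cong₂ _+_ (sum-*-sum b g) (sum-*-sum g b) ⟨
  sum b * sum g + sum g * sum b
    ≡⟨ double (sum b) (sum g) ⟩
  2 * (sum b * sum g) ∎)
  where
  open ≤-Reasoning
  b g : Fin n → ℕ
  b i = ⟦ P? i ⟧
  g i = f i * f i
  sum-*-sum : ∀ (f g : Fin n → ℕ) → sum f * sum g ≡ (∑[ i < n ] ∑[ j < n ] (f i * g j))
  sum-*-sum f g = ≡.trans (*-distribʳ-sum (sum g) f) (sum-cong-≗ λ i → *-distribˡ-sum (f i) g)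
  double : ∀ x y → x * y + y * x ≡ 2 * (x * y)
  double = solve-∀
  pointwise : ∀ i j (dᵢ : Dec _) (dⱼ : Dec _) → 2 * (f i * f j) ≤ ⟦ dᵢ ⟧ * g j + g i * ⟦ dⱼ ⟧
  pointwise i j (no ¬Pi) _        rewrite f≡0 i ¬Pi = z≤n
  pointwise i j (yes _)  (no ¬Pj) rewrite f≡0 j ¬Pj | *-zeroʳ (f i) = z≤n
  pointwise i j (yes _)  (yes _)  = ≤-trans (2xy≤xx+yy (f i) (f j)) (≤-reflexive (swap-sum (g i) (g j)))
    where
    swap-sum : ∀ x y → x + y ≡ 1 * y + x * 1
    swap-sum = solve-∀

-- From a permutation to a rainbow perfect matching

distinct-injective : (f : Fin m → Fin k) {l : List (Fin m)} → distinct (map f l) ≡ 1 →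
  ∀ {x y} → x ∈ l → y ∈ l → f x ≡ f y → x ≡ y
distinct-injective f d (here refl) (here refl) _ = refl
distinct-injective f {z ∷ l} d (here refl) (there y∈l) eq =
  contradiction (subst (_∈ map f l) (sym eq) (∈-map⁺ f y∈l)) (fresh⇒∉ (m*n≡1⇒m≡1 _ (distinct (map f l)) d))
distinct-injective f {z ∷ l} d (there x∈l) (here refl) eq =
  contradiction (subst (_∈ map f l) eq (∈-map⁺ f x∈l)) (fresh⇒∉ (m*n≡1⇒m≡1 _ (distinct (map f l)) d))
distinct-injective f {z ∷ l} d (there x∈l) (there y∈l) eq =
  distinct-injective f (m*n≡1⇒n≡1 (fresh (f z) (map f l)) _ d) x∈l y∈l eq

-- Pigeonhole: punching out a missed value would leave an injection into a smaller set. Surjectivity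
-- of σ supplies the matching edge at each right vertex.
injective⇒surjective : {f : Fin n → Fin n} → Injective _≡_ _≡_ f → ∀ j → ∃[ i ] f i ≡ j
injective⇒surjective {suc n} {f} f-inj j with any? (λ i → f i ≟ j)
... | yes i,fi≡j = i,fi≡j
... | no  ∄      = contradiction (injective⇒≤ {f = g} (f-inj ∘ punchOut-injective (j≢f _) (j≢f _))) 1+n≰n
  where
  j≢f : ∀ i → j ≢ f i
  j≢f i j≡fi = ∄ (i , sym j≡fi)
  g : Fin (suc n) → Fin n
  g i = punchOut (j≢f i)

-- The colouring occurs as a function `c`, as in `Pr`, and as its table `v`, in which single entries
-- can be overwritten; the two are linked pointwise. The matching is the graph of σ.
rainbowPerfectMatching : (c : Coloring n k) (v : Vec (Fin k) (n * n)) → lookup v ≗ c →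
  (σ : Vec (Fin n) n) → isPerm σ ≡ 1 → isRainbow v σ ≡ 1 → HasRainbowPerfectMatching n c
rainbowPerfectMatching {n} {k} c v v≗c σ σ-perm rainbow =
  M , (λ { (inj₁ i) → perfectˡ i ; (inj₂ j) → perfectʳ j }) , M-rainbow
  where
  row col : Edge n → Fin n
  row = quotient n
  col = remainder {n} n
  row-edge : ∀ i → row (matchingEdge σ i) ≡ i
  row-edge i = cong proj₁ (remQuot-combine i (lookup σ i))
  col-edge : ∀ i → col (matchingEdge σ i) ≡ lookup σ i
  col-edge i = cong proj₂ (remQuot-combine i (lookup σ i))
  M : Subset (n * n)
  M = tabulate (λ e → does (lookup σ (row e) ≟ col e))
  ∈M⇒ : ∀ {e} → e ∈ˢ M → lookup σ (row e) ≡ col e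
  ∈M⇒ {e} e∈M = toTrue (lookup σ (row e) ≟ col e) (≡.trans (sym (lookup∘tabulate _ e)) ([]=⇒lookup e∈M))
    where
    toTrue : {P : Set} (d : Dec P) → does d ≡ true → P
    toTrue (yes p) _ = p
  ⇒∈M : ∀ {e} → lookup σ (row e) ≡ col e → e ∈ˢ M
  ⇒∈M {e} eq = lookup⇒[]= e M (≡.trans (lookup∘tabulate _ e) (dec-true (lookup σ (row e) ≟ col e) eq))
  ∈M⇒edge : ∀ {e} → e ∈ˢ M → matchingEdge σ (row e) ≡ e
  ∈M⇒edge {e} e∈M = ≡.trans (cong (combine (row e)) (∈M⇒ e∈M)) (combine-remQuot {n} n e)
  edge∈M : ∀ i → matchingEdge σ i ∈ˢ M
  edge∈M i = ⇒∈M (≡.trans (cong (lookup σ) (row-edge i)) (sym (col-edge i)))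
  σ-injective : Injective _≡_ _≡_ (lookup σ)
  σ-injective = distinct-injective (lookup σ) σ-perm (∈-allFin _) (∈-allFin _)
  color-injective : ∀ {i i′} → lookup v (matchingEdge σ i) ≡ lookup v (matchingEdge σ i′) → i ≡ i′
  color-injective = distinct-injective (lookup v ∘ matchingEdge σ)
    (≡.trans (cong distinct (map-∘ (allFin n))) rainbow) (∈-allFin _) (∈-allFin _)
  perfectˡ : ∀ i → ∃! _≡_ λ e → e ∈ˢ M × IncidentTo n (inj₁ i) e
  perfectˡ i = matchingEdge σ i , (edge∈M i , inj₁ (cong inj₁ (sym (row-edge i)))) , unique
    where
    unique : ∀ {e} → e ∈ˢ M × IncidentTo n (inj₁ i) e → matchingEdge σ i ≡ e
    unique (e∈M , inj₁ refl) = ∈M⇒edge e∈M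
  perfectʳ : ∀ j → ∃! _≡_ λ e → e ∈ˢ M × IncidentTo n (inj₂ j) e
  perfectʳ j with i , refl ← injective⇒surjective σ-injective j =
    matchingEdge σ i , (edge∈M i , inj₂ (cong inj₂ (sym (col-edge i)))) , unique
    where
    unique : ∀ {e} → e ∈ˢ M × IncidentTo n (inj₂ (lookup σ i)) e → matchingEdge σ i ≡ e
    unique {e} (e∈M , inj₂ eq) = ≡.trans
      (cong (matchingEdge σ) (σ-injective (≡.trans (inj₂-injective eq) (sym (∈M⇒ e∈M))))) (∈M⇒edge e∈M)
  M-rainbow : IsRainbow n c M
  M-rainbow e f e∈M f∈M e≢f ce≡cf = e≢f (begin
    e                      ≡⟨ ∈M⇒edge e∈M ⟨
    matchingEdge σ (row e) ≡⟨ cong (matchingEdge σ) (color-injective colors) ⟩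
    matchingEdge σ (row f) ≡⟨ ∈M⇒edge f∈M ⟩
    f                      ∎)
    where
    open ≡-Reasoning
    colors : lookup v (matchingEdge σ (row e)) ≡ lookup v (matchingEdge σ (row f))
    colors = begin
      lookup v (matchingEdge σ (row e)) ≡⟨ cong (lookup v) (∈M⇒edge e∈M) ⟩
      lookup v e                        ≡⟨ v≗c e ⟩
      c e                               ≡⟨ ce≡cf ⟩
      c f                               ≡⟨ v≗c f ⟨
      lookup v f                        ≡⟨ cong (lookup v) (∈M⇒edge f∈M) ⟨
      lookup v (matchingEdge σ (row f)) ∎

-- Lower bound for the number of successful colourings

count-tabulate : {P : Pred A p} (P? : Decidable P) (f : Fin n → A) →
  count P? (tabulate f) ≡ (∑[ i < n ] ⟦ P? (f i) ⟧)
count-tabulate {n = zero}  P? f = refl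
count-tabulate {n = suc n} P? f with P? (f zero)
... | yes _ = cong suc (count-tabulate P? (f ∘ suc))
... | no  _ = count-tabulate P? (f ∘ suc)

module _ (n s : ℕ) where
  open Moments n s

  private
    hasRainbow? : Decidable (λ i → HasRainbowPerfectMatching n (finToFun {s} {n * n} i))
    hasRainbow? i = hasRainbowPerfectMatching? n (finToFun i)

  successes : ℕ
  successes = count (hasRainbowPerfectMatching? n {s}) (tabulate finToFun)

  private
    successes≡ : successes ≡ (∑[ i < s ^ (n * n) ] ⟦ hasRainbow? i ⟧)
    successes≡ = count-tabulate (hasRainbowPerfectMatching? n {s}) finToFun

  -- A nonzero term would produce a matching by `rainbowPerfectMatching`. This is the vanishing
  -- condition under which Cauchy-Schwarz brings in the number of successes.
  matchingCount≡0 : ∀ i → ¬ HasRainbowPerfectMatching n (finToFun {s} {n * n} i) → matchingCount (vec i) ≡ 0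
  matchingCount≡0 i none = ≡.trans (sum-cong-≗ {n ^ n} (λ j → zeroTerm (vec j))) (≡.trans (sum-const (n ^ n) 0) (*-zeroʳ (n ^ n)))
    where
    zeroTerm : ∀ σ → isPerm σ * isRainbow (vec i) σ ≡ 0
    zeroTerm σ with ≤1-dichotomy (*-mono-≤ (distinct≤1 (at σ (allFin n))) (distinct≤1 (at (vec i) (map (matchingEdge σ) (allFin n)))))
    ... | inj₁ ≡0 = ≡0
    ... | inj₂ ≡1 = contradiction
      (rainbowPerfectMatching (finToFun i) (vec i) (lookup∘tabulate (finToFun i)) σ
        (m*n≡1⇒m≡1 (isPerm σ) _ ≡1) (m*n≡1⇒n≡1 (isPerm σ) _ ≡1))
      none

  successes≤ : successes ≤ s ^ (n * n)
  successes≤ = count≤n (hasRainbowPerfectMatching? n {s}) (tabulate finToFun)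

  -- Both sides are multiplied by s ^ n * s ^ n and by S₁ * S₁, so that Cauchy-Schwarz and the two
  -- moments apply; cancelling again requires S₁ to be positive.
  successes≥ : 4 ≤ n → n ≤ s → n * s ^ (n * n) ≤ (n + 9) * successes
  successes≥ 4≤n n≤s = *-cancelʳ-≤ _ _ (S₁ * S₁) {{m*n≢0 S₁ S₁}} (*-cancelˡ-≤ (s ^ n * s ^ n) {{m*n≢0 (s ^ n) (s ^ n)}} (begin
    s ^ n * s ^ n * (n * T * (S₁ * S₁))
      ≤⟨ *-monoʳ-≤ (s ^ n * s ^ n) (*-monoʳ-≤ (n * T) (subst (λ z → S₁ * S₁ ≤ z * S₂) (sym successes≡) (sum-cauchy-schwarz hasRainbow? (matchingCount ∘ vec) matchingCount≡0))) ⟩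
    s ^ n * s ^ n * (n * T * (successes * S₂))
      ≡⟨ regroup (s ^ n) n T successes S₂ ⟩
    T * successes * (n * (s ^ n * (s ^ n * S₂)))
      ≤⟨ *-monoʳ-≤ (T * successes) (second-moment 4≤n n≤s) ⟩
    T * successes * (n ! * ((n + 9) * (n ! * fall s n) * (fall s n * T)))
      ≡⟨ regroup′ T successes (n !) (n + 9) (fall s n) ⟩
    (n + 9) * successes * (n ! * (fall s n * T) * (n ! * (fall s n * T)))
      ≡⟨ cong (λ z → (n + 9) * successes * (z * z)) first-moment ⟨
    (n + 9) * successes * (s ^ n * S₁ * (s ^ n * S₁))
      ≡⟨ regroup″ ((n + 9) * successes) (s ^ n) S₁ ⟩
    s ^ n * s ^ n * ((n + 9) * successes * (S₁ * S₁)) ∎))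
    where
    open ≤-Reasoning
    T = s ^ (n * n)
    S₁ = ∑ⱽ matchingCount
    S₂ = ∑ⱽ (λ c → matchingCount c * matchingCount c)
    regroup : ∀ a n t p x → a * a * (n * t * (p * x)) ≡ t * p * (n * (a * (a * x)))
    regroup = solve-∀
    regroup′ : ∀ t p f m g → t * p * (f * (m * (f * g) * (g * t))) ≡ m * p * (f * (g * t) * (f * (g * t)))
    regroup′ = solve-∀
    regroup″ : ∀ a b c → a * (b * c * (b * c)) ≡ b * b * (a * (c * c))
    regroup″ = solve-∀
    instance
      s≢0 : NonZero s
      s≢0 = >-nonZero (≤-trans (≤-trans (s≤s z≤n) 4≤n) n≤s)
      s^n≢0 : NonZero (s ^ n)
      s^n≢0 = m^n≢0 s n
      n!fallT≢0 : NonZero (n ! * (fall s n * T))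
      n!fallT≢0 = m*n≢0 (n !) (fall s n * T) {{n !≢0}} {{m*n≢0 (fall s n) T {{>-nonZero (fall>0 n≤s)}} {{m^n≢0 s (n * n)}}}}
      -- By the first moment, as `fall s n` is positive for n ≤ s.
      S₁≢0 : NonZero S₁
      S₁≢0 = m*n≢0⇒n≢0 (s ^ n) {{subst NonZero (sym first-moment) n!fallT≢0}}

-- Passage to rationals and the limit

module _ where
  open import Data.Integer using (+_)

  -- The numerator of a positive ε is at least 1, so ε is at least 1 / ↧ₙ ε, and (t - p) / t only
  -- has to stay below that.
  ∣p/t-1∣<ε : ∀ p t .{{_ : NonZero t}} (ε : ℚ) → 0ℚ ℚ.< ε → p ≤ t → (t ∸ p) * ↧ₙ ε < t →
    ℚ.∣ + p / t - 1ℚ ∣ ℚ.< ε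
  ∣p/t-1∣<ε p (suc t) ε@(mkℚ (+ zero)  _ _) (ℚ.*<* (ℤ.+<+ ())) _   _
  ∣p/t-1∣<ε p (suc t) ε@(mkℚ (+ suc e) d _) _ p≤t close =
    ℚ.toℚᵘ-cancel-< (ℚᵘ.<-respˡ-≃ (ℚᵘ.≃-sym unnormalise) (*<* (subst₂ ℤ._<_
      (≡.trans (ℤ.pos-* (suc t ∸ p) (suc d)) (cong (λ z → + z ℤ.* + suc d) (sym numerator)))
      (ℤ.pos-* (suc e) (suc t * 1))
      (ℤ.+<+ (<-≤-trans close (≤-trans (≤-reflexive (sym (*-identityʳ (suc t)))) (m≤m+n _ _)))))))
    where
    unnormalise : toℚᵘ ℚ.∣ + p / suc t - 1ℚ ∣ ℚᵘ.≃ ℚᵘ.∣ mkℚᵘ (+ p) t ℚᵘ.- ℚᵘ.1ℚᵘ ∣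
    unnormalise = ℚᵘ.≃-trans (ℚ.toℚᵘ-homo-∣-∣ (+ p / suc t - 1ℚ))
      (ℚᵘ.∣-∣-cong (ℚᵘ.≃-trans (ℚ.toℚᵘ-homo-+ (+ p / suc t) (ℚ.- 1ℚ))
        (ℚᵘ.+-congˡ _ (ℚ.toℚᵘ-fromℚᵘ (mkℚᵘ (+ p) t)))))
    numerator : ℤ.∣ + p ℤ.* + 1 ℤ.+ ℤ.-1ℤ ℤ.* + suc t ∣ ≡ suc t ∸ p
    numerator = ≡.trans (cong ℤ.∣_∣ (≡.trans (cong₂ ℤ._+_ (ℤ.*-identityʳ (+ p)) (ℤ.-1*i≡-i (+ suc t))) (ℤ.m-n≡m⊖n p (suc t))))
      (ℤ.∣⊖∣-≤ p≤t)

-- For f = t - p the bound gives n f ≤ 9 p ≤ 9 t, while 9 q < n; hence 9 q f < 9 t.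
gap-< : ∀ {n p t} q → 0 < t → p ≤ t → 4 + 9 * q ≤ n → n * t ≤ (n + 9) * p → (t ∸ p) * q < t
gap-< {n} {p} q 0<t p≤t N≤n bound with m≤n⇒∃[o]m+o≡n p≤t
... | f , refl = subst (λ z → z * q < p + f) (sym (m+n∸m≡n p f)) (small f 0<t bound)
  where
  small : ∀ f → 0 < p + f → n * (p + f) ≤ (n + 9) * p → f * q < p + f
  -- For f = 0 multiplying 9 q < n by f is not strict, and 0 < t takes over.
  small zero    0<t _     = 0<t
  small (suc f) _   bound = *-cancelˡ-< 9 _ _ (begin-strict
    9 * (suc f * q)          ≡⟨ x∙yz≈xz∙y 9 (suc f) q ⟩
    9 * q * suc f            <⟨ *-monoˡ-< (suc f) (<-≤-trans (s≤s (m≤n+m (9 * q) 3)) N≤n) ⟩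
    n * suc f                ≤⟨ +-cancelˡ-≤ (n * p) _ _ (≤-trans (≤-reflexive (sym (*-distribˡ-+ n p (suc f)))) (≤-trans bound (≤-reflexive (*-distribʳ-+ p n 9)))) ⟩
    9 * p                    ≤⟨ *-monoʳ-≤ 9 (m≤m+n p (suc f)) ⟩
    9 * (p + suc f)          ∎)
    where
    open ≤-Reasoning

theorem5 : (s : ℕ → ℕ) (s≥n : (n : ℕ) → s n ≥ n) →
    TendsTo (λ n → PrRainbowPerfectMatching n (s n) (s≥n n)) 1ℚ
-- The 4 serves the estimate of the inner factors by 3 s / 2; n > 9 * ↧ₙ ε makes 9 / n smaller than
-- 1 / ↧ₙ ε.
theorem5 s s≥n ε ε>0 = 4 + 9 * ↧ₙ ε , λ n N≤n →
  ∣p/t-1∣<ε (successes n (s n)) (s n ^ (n * n)) {{k^[n*n]≢0 n (s≥n n)}} ε ε>0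
    (successes≤ n (s n))
    (gap-< (↧ₙ ε) (>-nonZero⁻¹ _ {{k^[n*n]≢0 n (s≥n n)}}) (successes≤ n (s n)) N≤n
      (successes≥ n (s n) (≤-trans (m≤m+n 4 _) N≤n) (s≥n n)))
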